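{- Let $T$ be an $L$-theory extending $I\Sigma_1$ such that for some $K\in\mathbb{N}$ and some $\varepsilon>0$, $T$ proves: for all pairwise coprime $a,b,c$ with $a+b=c$, $c < K\,\mathrm{rad}(abc)^{1+\varepsilon}$; and $T$ proves Fermat's Last Theorem for the definable exponential $x^y$ (no $a,b,c\neq 0$ and $n>2$ with $a^n+b^n=c^n$). Then $T + \mathrm{Exp}' + (\mathrm{e5}') + (\mathrm{e8})$ proves Fermat's Last Theorem for $e$: there are no non-zero $x,y,z\in B$ and $n\in A$ with $n>2$ such that $e(x,n)+e(y,n)=e(z,n)$.
   Context: $L = \langle 0,1,+,\cdot,\le\rangle$, $L^e = \langle 0,1,+,\cdot,e,\le\rangle$ with $e$ a binary (possibly partial) function symbol. $x^y$ is the exponential $\Delta_1$-definable in $I\Sigma_1$; $\mathrm{rad}(a)$ is the product of the distinct primes dividing $a$. Presburger arithmetic $\mathrm{Pr}$: $0 \ne z+1$; $x\neq 0 \to \exists z\,(x = z+1)$; $x+z=y+z\to x=y$; $x+0=x$; associativity and commutativity of $+$; $x\le y \leftrightarrow \exists z\,(x+z=y)$; for each standard $0<n$, $\exists y\,(ny \le x < n(y+1))$. $\mathrm{Exp}'$ consists of: (e0) there is an $L$-substructure $\mathcal{A}$ of $\mathcal{B}$ (universe $A$) satisfying $\mathrm{Pr}$ with $e: B\times A\to B$; and for all $x\in B$, $y,z\in A$: (e1) $(x=1\vee y=0)\leftrightarrow e(x,y)=1$; (e2) $x\neq0\to e(x,y)\ne0$; (e3) $e(x,1)=x$; (e4) $e(x,y+z)=e(x,y)e(x,z)$.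 Further axioms: (e5') $e(xy,z)=e(x,z)\cdot e(y,z)$ for $x,y\in B$, $z\in A$; (e8) for all $x,y\in B$ and $a,b\in A$: if $x$ and $y$ are coprime, then $e(x,a)$ and $e(y,b)$ are coprime. -}

module Defs where

open import Level using (Level; 0ℓ) renaming (suc to lsuc)
open import Data.Nat.Base using (ℕ; zero; suc; NonZero) renaming (_+_ to _+ℕ_)
open import Data.Integer.Base using (∣_∣)
open import Data.Rational.Base using (ℚ; ↥_; ↧ₙ_)
open import Data.Fin.Base using (Fin; zero; suc; _↑ʳ_)
open import Data.List.Base using (List; []; _∷_; map)
open import Data.List.Membership.Propositional using (_∈_)
open import Data.Product.Base using (∃; _×_)
open import Relation.Binary.PropositionalEquality.Core using (_≡_)
open import Relation.Unary using (Pred)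

-- L is the language of ordered semirings. Lᵉ adds the function symbol 𝕖 and
-- a unary predicate symbol 𝔸 for the universe A of the substructure.
--
-- The partial function e : B × A → B is rendered by a function symbol whose
-- values at exponents outside 𝔸 are unconstrained: every axiom and the
-- conclusion mention 𝕖 s t only for t in 𝔸.

data Lang : Set where
  L Lᵉ : Lang

infix  9 var_
infixl 8 _·_
infixl 7 _+̇_
infix  6 _≐_ _≤̇_ _<̇_ _∣̇_
infix  5 ¬̇_
infixr 4 _∧̇_
infixr 3 _∨̇_
infixr 2 _⇒_
infix  2 _⇔̇_
infixr 1 ∀̇_ ∃̇_

data Term : Lang → ℕ → Set where
  var_ : ∀ {l n} → Fin n → Term l n
  0̇ 1̇  : ∀ {l n} → Term l n
  _+̇_  : ∀ {l n} → Term l n → Term l n → Term l n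
  _·_  : ∀ {l n} → Term l n → Term l n → Term l n
  𝕖    : ∀ {n} → Term Lᵉ n → Term Lᵉ n → Term Lᵉ n

-- Formula l n: formulas with free variables among n de Bruijn indices.

data Formula : Lang → ℕ → Set where
  ⊥̇   : ∀ {l n} → Formula l n
  _≐_ : ∀ {l n} → Term l n → Term l n → Formula l n
  _≤̇_ : ∀ {l n} → Term l n → Term l n → Formula l n
  𝔸   : ∀ {n} → Term Lᵉ n → Formula Lᵉ n
  _⇒_ : ∀ {l n} → Formula l n → Formula l n → Formula l n
  ∀̇_  : ∀ {l n} → Formula l (suc n) → Formula l n

Sentence : Lang → Set
Sentence l = Formula l 0

Theory : Lang → (ℓ : Level) → Set (lsuc ℓ)
Theory l ℓ = Pred (Sentence l) ℓ

private
  variable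
    l : Lang
    m n : ℕ
    ℓ : Level

-- Classical abbreviations; the calculus below has reductio ad absurdum.

¬̇_ : Formula l n → Formula l n
¬̇ φ = φ ⇒ ⊥̇

_∧̇_ _∨̇_ _⇔̇_ : Formula l n → Formula l n → Formula l n
φ ∧̇ ψ = ¬̇ (φ ⇒ ¬̇ ψ)
φ ∨̇ ψ = ¬̇ φ ⇒ ψ
φ ⇔̇ ψ = (φ ⇒ ψ) ∧̇ (ψ ⇒ φ)

∃̇_ : Formula l (suc n) → Formula l n
∃̇ φ = ¬̇ (∀̇ ¬̇ φ)

_<̇_ : Term l n → Term l n → Formula l n
s <̇ t = s ≤̇ t ∧̇ ¬̇ s ≐ t

------------------------------------------------------------------------
-- Substitution

renT : (Fin m → Fin n) → Term l m → Term l n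
renT ρ (var i)  = var (ρ i)
renT ρ 0̇        = 0̇
renT ρ 1̇        = 1̇
renT ρ (s +̇ t)  = renT ρ s +̇ renT ρ t
renT ρ (s · t)  = renT ρ s · renT ρ t
renT ρ (𝕖 s t)  = 𝕖 (renT ρ s) (renT ρ t)

wk : ∀ k → Term l n → Term l (k +ℕ n)
wk k = renT (k ↑ʳ_)

liftR : (Fin m → Fin n) → Fin (suc m) → Fin (suc n)
liftR ρ zero    = zero
liftR ρ (suc i) = suc (ρ i)

ren : (Fin m → Fin n) → Formula l m → Formula l n
ren ρ ⊥̇        = ⊥̇
ren ρ (s ≐ t)  = renT ρ s ≐ renT ρ t
ren ρ (s ≤̇ t)  = renT ρ s ≤̇ renT ρ t
ren ρ (𝔸 t)    = 𝔸 (renT ρ t)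
ren ρ (φ ⇒ ψ)  = ren ρ φ ⇒ ren ρ ψ
ren ρ (∀̇ φ)    = ∀̇ ren (liftR ρ) φ

subT : (Fin m → Term l n) → Term l m → Term l n
subT σ (var i)  = σ i
subT σ 0̇        = 0̇
subT σ 1̇        = 1̇
subT σ (s +̇ t)  = subT σ s +̇ subT σ t
subT σ (s · t)  = subT σ s · subT σ t
subT σ (𝕖 s t)  = 𝕖 (subT σ s) (subT σ t)

liftS : (Fin m → Term l n) → Fin (suc m) → Term l (suc n)
liftS σ zero    = var zero
liftS σ (suc i) = wk 1 (σ i)

sub : (Fin m → Term l n) → Formula l m → Formula l n
sub σ ⊥̇        = ⊥̇
sub σ (s ≐ t)  = subT σ s ≐ subT σ t
sub σ (s ≤̇ t)  = subT σ s ≤̇ subT σ t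
sub σ (𝔸 t)    = 𝔸 (subT σ t)
sub σ (φ ⇒ ψ)  = sub σ φ ⇒ sub σ ψ
sub σ (∀̇ φ)    = ∀̇ sub (liftS σ) φ

inst : Term l n → Fin (suc n) → Term l n
inst t zero    = t
inst t (suc i) = var i

infix 10 _[_]

_[_] : Formula l (suc n) → Term l n → Formula l n
φ [ t ] = sub (inst t) φ

-- φ(x) ↦ φ(x + 1), where x is the variable of index 0.

shift : Formula l (suc n) → Formula l (suc n)
shift = sub λ { zero → var zero +̇ 1̇ ; (suc i) → var (suc i) }

closure : ∀ {n} → Formula l n → Sentence l
closure {n = zero}  φ = φ
closure {n = suc n} φ = closure (∀̇ φ)

------------------------------------------------------------------------
-- Classical first-order provability with equality (natural deduction)

infix 0 _∣_⊢_ _⊢_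

data _∣_⊢_ {l : Lang} {ℓ : Level} (T : Theory l ℓ) : ∀ {n} → List (Formula l n) → Formula l n → Set ℓ where
  axiom   : ∀ {n} {Γ : List (Formula l n)} {φ : Sentence l} → T φ → T ∣ Γ ⊢ ren (λ ()) φ
  hyp     : ∀ {n} {Γ : List (Formula l n)} {φ} → φ ∈ Γ → T ∣ Γ ⊢ φ
  ⇒-intro : ∀ {n} {Γ : List (Formula l n)} {φ ψ} → T ∣ φ ∷ Γ ⊢ ψ → T ∣ Γ ⊢ (φ ⇒ ψ)
  ⇒-elim  : ∀ {n} {Γ : List (Formula l n)} {φ ψ} → T ∣ Γ ⊢ (φ ⇒ ψ) → T ∣ Γ ⊢ φ → T ∣ Γ ⊢ ψ
  raa     : ∀ {n} {Γ : List (Formula l n)} {φ} → T ∣ (¬̇ φ) ∷ Γ ⊢ ⊥̇ → T ∣ Γ ⊢ φ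
  ∀-intro : ∀ {n} {Γ : List (Formula l n)} {φ} → T ∣ map (ren suc) Γ ⊢ φ → T ∣ Γ ⊢ (∀̇ φ)
  ∀-elim  : ∀ {n} {Γ : List (Formula l n)} {φ} → T ∣ Γ ⊢ (∀̇ φ) → (t : Term l n) → T ∣ Γ ⊢ φ [ t ]
  ≐-refl  : ∀ {n} {Γ : List (Formula l n)} {t} → T ∣ Γ ⊢ t ≐ t
  ≐-subst : ∀ {n} {Γ : List (Formula l n)} {s t} (φ : Formula l (suc n)) →
            T ∣ Γ ⊢ s ≐ t → T ∣ Γ ⊢ φ [ s ] → T ∣ Γ ⊢ φ [ t ]

_⊢_ : Theory l ℓ → Sentence l → Set ℓ
T ⊢ φ = T ∣ [] ⊢ φ

Extends : Theory l ℓ → Theory l 0ℓ → Set ℓ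
Extends T U = ∀ φ → U φ → T ⊢ φ

------------------------------------------------------------------------
-- Arithmetic

v₀ : Term l (1 +ℕ n)
v₀ = var zero
v₁ : Term l (2 +ℕ n)
v₁ = var (suc zero)
v₂ : Term l (3 +ℕ n)
v₂ = var (suc (suc zero))
v₃ : Term l (4 +ℕ n)
v₃ = var (suc (suc (suc zero)))
v₄ : Term l (5 +ℕ n)
v₄ = var (suc (suc (suc (suc zero))))

infix 8 _×̇_
infix 9 _^̇_

-- t + ⋯ + t and t · ⋯ · t for a standard number of occurrences.

_×̇_ : ℕ → Term l n → Term l n
zero  ×̇ t = 0̇
suc k ×̇ t = k ×̇ t +̇ t

_^̇_ : Term l n → ℕ → Term l n
t ^̇ zero  = 1̇
t ^̇ suc k = t ^̇ k · t

numeral : ℕ → Term l n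
numeral k = k ×̇ 1̇

∀≤ ∃≤ : Term l n → Formula l (suc n) → Formula l n
∀≤ t φ = ∀̇ (v₀ ≤̇ wk 1 t ⇒ φ)
∃≤ t φ = ∃̇ (v₀ ≤̇ wk 1 t ∧̇ φ)

data Δ₀ : ∀ {n} → Formula L n → Set where
  ⊥̇    : ∀ {n} → Δ₀ {n} ⊥̇
  _≐_  : ∀ {n} (s t : Term L n) → Δ₀ (s ≐ t)
  _≤̇_  : ∀ {n} (s t : Term L n) → Δ₀ (s ≤̇ t)
  _⇒_  : ∀ {n} {φ ψ : Formula L n} → Δ₀ φ → Δ₀ ψ → Δ₀ (φ ⇒ ψ)
  all≤ : ∀ {n} (t : Term L n) {φ : Formula L (suc n)} → Δ₀ φ → Δ₀ (∀≤ t φ)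
  ex≤  : ∀ {n} (t : Term L n) {φ : Formula L (suc n)} → Δ₀ φ → Δ₀ (∃≤ t φ)

data Σ₁ : ∀ {n} → Formula L n → Set where
  Δ₀⊆Σ₁ : ∀ {n} {φ : Formula L n} → Δ₀ φ → Σ₁ φ
  ex    : ∀ {n} {φ : Formula L (suc n)} → Σ₁ φ → Σ₁ (∃̇ φ)

-- PA⁻: the theory of nonnegative parts of discretely ordered rings.

data PA⁻ : Theory L 0ℓ where
  +-assoc  : PA⁻ (∀̇ ∀̇ ∀̇ (v₂ +̇ v₁) +̇ v₀ ≐ v₂ +̇ (v₁ +̇ v₀))
  +-comm   : PA⁻ (∀̇ ∀̇ v₁ +̇ v₀ ≐ v₀ +̇ v₁)
  ·-assoc  : PA⁻ (∀̇ ∀̇ ∀̇ (v₂ · v₁) · v₀ ≐ v₂ · (v₁ · v₀))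
  ·-comm   : PA⁻ (∀̇ ∀̇ v₁ · v₀ ≐ v₀ · v₁)
  distrib  : PA⁻ (∀̇ ∀̇ ∀̇ v₂ · (v₁ +̇ v₀) ≐ v₂ · v₁ +̇ v₂ · v₀)
  +-zero   : PA⁻ (∀̇ v₀ +̇ 0̇ ≐ v₀)
  ·-zero   : PA⁻ (∀̇ v₀ · 0̇ ≐ 0̇)
  ·-one    : PA⁻ (∀̇ v₀ · 1̇ ≐ v₀)
  ≤-refl   : PA⁻ (∀̇ v₀ ≤̇ v₀)
  ≤-trans  : PA⁻ (∀̇ ∀̇ ∀̇ v₂ ≤̇ v₁ ⇒ v₁ ≤̇ v₀ ⇒ v₂ ≤̇ v₀)
  ≤-antisym : PA⁻ (∀̇ ∀̇ v₁ ≤̇ v₀ ⇒ v₀ ≤̇ v₁ ⇒ v₁ ≐ v₀)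
  ≤-total  : PA⁻ (∀̇ ∀̇ v₁ ≤̇ v₀ ∨̇ v₀ ≤̇ v₁)
  +-mono-< : PA⁻ (∀̇ ∀̇ ∀̇ v₂ <̇ v₁ ⇒ v₂ +̇ v₀ <̇ v₁ +̇ v₀)
  ·-mono-< : PA⁻ (∀̇ ∀̇ ∀̇ 0̇ <̇ v₀ ⇒ v₂ <̇ v₁ ⇒ v₂ · v₀ <̇ v₁ · v₀)
  ≤-diff   : PA⁻ (∀̇ ∀̇ v₁ ≤̇ v₀ ⇒ (∃̇ v₂ +̇ v₀ ≐ v₁))
  0<1      : PA⁻ (0̇ <̇ 1̇)
  discrete : PA⁻ (∀̇ 0̇ <̇ v₀ ⇒ 1̇ ≤̇ v₀)
  0≤       : PA⁻ (∀̇ 0̇ ≤̇ v₀)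

data IΣ₁ : Theory L 0ℓ where
  pa⁻       : ∀ {φ} → PA⁻ φ → IΣ₁ φ
  induction : ∀ {n} (φ : Formula L (suc n)) → Σ₁ φ →
              IΣ₁ (closure (φ [ 0̇ ] ⇒ (∀̇ (φ ⇒ shift φ)) ⇒ (∀̇ φ)))

_∣̇_ : Term l n → Term l n → Formula l n
s ∣̇ t = ∃̇ wk 1 s · v₀ ≐ wk 1 t

Coprime : Term l n → Term l n → Formula l n
Coprime s t = ∀̇ (v₀ ∣̇ wk 1 s ⇒ v₀ ∣̇ wk 1 t ⇒ v₀ ≐ 1̇)

Prime : Term l n → Formula l n
Prime p = 1̇ <̇ p ∧̇ (∀̇ (v₀ ∣̇ wk 1 p ⇒ v₀ ≐ 1̇ ∨̇ v₀ ≐ wk 1 p))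

-- Gödel's β function: v is the remainder of c modulo 1 + (i + 1) d.

β : (c d i v : Term l n) → Formula l n
β c d i v = v ≤̇ (i +̇ 1̇) · d
         ∧̇ ∃≤ c (wk 1 c ≐ v₀ · (1̇ +̇ (wk 1 i +̇ 1̇) · wk 1 d) +̇ wk 1 v)

-- Recursion k step z: there is a sequence s₀, …, s_k (β-coded by c, d) with
-- s₀ = 1, s_k = z and step for all i < k. In step, the indices 0, 1, 2, 3, 4
-- stand for s_{i+1}, s_i, i, d, c; step is not meant to use the last two.

Recursion : Term l n → Formula l (5 +ℕ n) → Term l n → Formula l n
Recursion k step z =
  ∃̇ ∃̇ β v₁ v₀ 0̇ 1̇
    ∧̇ ∀≤ (wk 2 k) (v₀ <̇ wk 3 k ⇒
        ∃≤ v₂ (∃≤ v₃ (β v₄ v₃ v₂ v₁ ∧̇ β v₄ v₃ (v₂ +̇ 1̇) v₀ ∧̇ step)))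
    ∧̇ β v₁ v₀ (wk 2 k) (wk 2 z)

-- x ^ y = z, by s_{i+1} = s_i · x.

Exp : (x y z : Term l n) → Formula l n
Exp x y z = Recursion y (v₀ ≐ v₁ · wk 5 x) z

-- rad(a) = r, for a ≠ 0: s_i is the product of the primes p ≤ i dividing a,
-- and every prime divisor of a is at most a.

Rad : (a r : Term l n) → Formula l n
Rad a r = Recursion a
  ((PrimeDivisor ⇒ v₀ ≐ v₁ · (v₂ +̇ 1̇)) ∧̇ (¬̇ PrimeDivisor ⇒ v₀ ≐ v₁)) r
  where PrimeDivisor = Prime (v₂ +̇ 1̇) ∧̇ (v₂ +̇ 1̇) ∣̇ wk 5 a

------------------------------------------------------------------------
-- The hypotheses on T

-- With ε = p / q, the bound c < K rad(abc)^(1+ε) is c^q < K^q rad(abc)^(q+p).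
-- As rad is defined on nonzero arguments only, a, b, c are taken nonzero
-- (c ≠ 0 follows from a ≠ 0).

ABC : ℕ → ℚ → Sentence L
ABC K ε =
  ∀̇ ∀̇ ∀̇ (¬̇ a ≐ 0̇ ⇒ ¬̇ b ≐ 0̇ ⇒
           Coprime a b ⇒ Coprime a c ⇒ Coprime b c ⇒ a +̇ b ≐ c ⇒
           (∃̇ (Rad (wk 1 (a · b · c)) v₀
              ∧̇ wk 1 c ^̇ q <̇ numeral K ^̇ q · v₀ ^̇ (q +ℕ p))))
  where
  p = ∣ ↥ ε ∣
  q = ↧ₙ ε
  a b c : Term L 3
  a = v₂
  b = v₁
  c = v₀

FLT : Sentence L
FLT =
  ∀̇ ∀̇ ∀̇ ∀̇ (¬̇ a ≐ 0̇ ⇒ ¬̇ b ≐ 0̇ ⇒ ¬̇ c ≐ 0̇ ⇒ numeral 2 <̇ k ⇒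
             ¬̇ (∃̇ ∃̇ ∃̇ (Exp (wk 3 a) (wk 3 k) v₂
                      ∧̇ Exp (wk 3 b) (wk 3 k) v₁
                      ∧̇ Exp (wk 3 c) (wk 3 k) v₀
                      ∧̇ v₂ +̇ v₁ ≐ v₀)))
  where
  a b c k : Term L 4
  a = v₃
  b = v₂
  c = v₁
  k = v₀

------------------------------------------------------------------------
-- Presburger arithmetic and exponential axioms

data Pr : Theory L 0ℓ where
  0≢suc    : Pr (∀̇ ¬̇ 0̇ ≐ v₀ +̇ 1̇)
  pred     : Pr (∀̇ (¬̇ v₀ ≐ 0̇ ⇒ (∃̇ v₁ ≐ v₀ +̇ 1̇)))
  +-cancel : Pr (∀̇ ∀̇ ∀̇ (v₂ +̇ v₀ ≐ v₁ +̇ v₀ ⇒ v₂ ≐ v₁))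
  +-zero   : Pr (∀̇ v₀ +̇ 0̇ ≐ v₀)
  +-assoc  : Pr (∀̇ ∀̇ ∀̇ (v₂ +̇ v₁) +̇ v₀ ≐ v₂ +̇ (v₁ +̇ v₀))
  +-comm   : Pr (∀̇ ∀̇ v₁ +̇ v₀ ≐ v₀ +̇ v₁)
  ≤-def    : Pr (∀̇ ∀̇ (v₁ ≤̇ v₀ ⇔̇ (∃̇ v₂ +̇ v₀ ≐ v₁)))
  division : ∀ k → .{{NonZero k}} →
             Pr (∀̇ ∃̇ (k ×̇ v₀ ≤̇ v₁ ∧̇ v₁ <̇ k ×̇ (v₀ +̇ 1̇)))

embedT : Term L n → Term Lᵉ n
embedT (var i)  = var i
embedT 0̇        = 0̇
embedT 1̇        = 1̇
embedT (s +̇ t)  = embedT s +̇ embedT t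
embedT (s · t)  = embedT s · embedT t

embed : Formula L n → Formula Lᵉ n
embed ⊥̇        = ⊥̇
embed (s ≐ t)  = embedT s ≐ embedT t
embed (s ≤̇ t)  = embedT s ≤̇ embedT t
embed (φ ⇒ ψ)  = embed φ ⇒ embed ψ
embed (∀̇ φ)    = ∀̇ embed φ

⌜_⌝ : Theory L ℓ → Theory Lᵉ ℓ
⌜ T ⌝ φ = ∃ λ ψ → T ψ × embed ψ ≡ φ

-- Truth of an L-formula in the substructure with universe 𝔸.

_ᴬ : Formula L n → Formula Lᵉ n
⊥̇ ᴬ        = ⊥̇
(s ≐ t) ᴬ  = embedT s ≐ embedT t
(s ≤̇ t) ᴬ  = embedT s ≤̇ embedT t
(φ ⇒ ψ) ᴬ  = φ ᴬ ⇒ ψ ᴬ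
(∀̇ φ) ᴬ    = ∀̇ (𝔸 v₀ ⇒ φ ᴬ)

data Exp′ : Theory Lᵉ 0ℓ where
  e0-0  : Exp′ (𝔸 0̇)
  e0-1  : Exp′ (𝔸 1̇)
  e0-+  : Exp′ (∀̇ ∀̇ (𝔸 v₁ ⇒ 𝔸 v₀ ⇒ 𝔸 (v₁ +̇ v₀)))
  e0-·  : Exp′ (∀̇ ∀̇ (𝔸 v₁ ⇒ 𝔸 v₀ ⇒ 𝔸 (v₁ · v₀)))
  e0-Pr : ∀ {φ} → Pr φ → Exp′ (φ ᴬ)
  e1    : Exp′ (∀̇ ∀̇ (𝔸 v₀ ⇒ (v₁ ≐ 1̇ ∨̇ v₀ ≐ 0̇ ⇔̇ 𝕖 v₁ v₀ ≐ 1̇)))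
  e2    : Exp′ (∀̇ ∀̇ (𝔸 v₀ ⇒ ¬̇ v₁ ≐ 0̇ ⇒ ¬̇ 𝕖 v₁ v₀ ≐ 0̇))
  e3    : Exp′ (∀̇ 𝕖 v₀ 1̇ ≐ v₀)
  e4    : Exp′ (∀̇ ∀̇ ∀̇ (𝔸 v₁ ⇒ 𝔸 v₀ ⇒ 𝕖 v₂ (v₁ +̇ v₀) ≐ 𝕖 v₂ v₁ · 𝕖 v₂ v₀))

e5′ : Sentence Lᵉ
e5′ = ∀̇ ∀̇ ∀̇ (𝔸 v₀ ⇒ 𝕖 (v₂ · v₁) v₀ ≐ 𝕖 v₂ v₀ · 𝕖 v₁ v₀)

e8 : Sentence Lᵉ
e8 = ∀̇ ∀̇ ∀̇ ∀̇ (𝔸 v₁ ⇒ 𝔸 v₀ ⇒ Coprime v₃ v₂ ⇒ Coprime (𝕖 v₃ v₁) (𝕖 v₂ v₀))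

FLTᵉ : Sentence Lᵉ
FLTᵉ = ¬̇ (∃̇ ∃̇ ∃̇ ∃̇ (¬̇ v₃ ≐ 0̇ ∧̇ ¬̇ v₂ ≐ 0̇ ∧̇ ¬̇ v₁ ≐ 0̇
                     ∧̇ 𝔸 v₀ ∧̇ numeral 2 <̇ v₀
                     ∧̇ 𝕖 v₃ v₀ +̇ 𝕖 v₂ v₀ ≐ 𝕖 v₁ v₀))

{-# OPTIONS --safe #-}

-- A solution x, y, z, n of Fermat's equation for e can be divided by gcds until x and y
-- are coprime; by (e8) so are a = e(x,n), b = e(y,n), c = e(z,n), and every prime dividing
-- abc divides xyz, whence rad(abc) ≤ xyz. If n ≥ m for a standard m, then by (e4)
-- x^m, y^m, z^m ≤ c, and for m large in terms of K and ε the bound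
-- c^q < K^q (xyz)^(q+p) is violated. Otherwise n is a standard number, e(x,n) is the
-- definable power x^n, and Fermat's Last Theorem in T applies.
--
-- The argument is carried out in structures. This suffices by Henkin's completeness
-- theorem, which holds constructively once structures may interpret ⊥ by an arbitrary
-- type: the Lindenbaum construction adds a formula if that preserves consistency
-- relative to the current stage, and this need not be decided.

module Submission where

open import Defs hiding (+-assoc; +-comm; ·-assoc; ·-comm; distrib; +-zero; ·-zero; ·-one;
  ≤-refl; ≤-trans; ≤-antisym; ≤-total; +-mono-<; ·-mono-<; ≤-diff; discrete; 0≤; 0<1)
open import Level using (Level; Lift; lift; _⊔_) renaming (suc to lsuc)
open import Algebra.Bundles using (CommutativeSemiring)
open import Algebra.Structures.Biased using (isCommutativeSemiringʳ)
open import Data.Empty using (⊥-elim)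
open import Data.Fin.Base using (Fin; zero; suc)
import Data.Integer.Base as ℤ
open import Data.List.Base using (List; []; _∷_; map; _++_; allFin; cartesianProductWith; upTo; concatMap)
open import Data.List.Properties using (++-assoc)
open import Data.List.Membership.Propositional using (_∈_)
open import Data.List.Membership.Propositional.Properties
  using (∈-map⁺; ∈-++⁺ˡ; ∈-++⁺ʳ; ∈-cartesianProductWith⁺; ∈-allFin; ∈-upTo⁺; ∈-concatMap⁺; ∈-∃++)
open import Data.List.Relation.Binary.Subset.Propositional using (_⊆_)
open import Data.List.Relation.Binary.Subset.Propositional.Properties using (map⁺; ∷⁺ʳ; xs⊆xs++ys; xs⊆ys++xs)
open import Data.List.Relation.Unary.All as All using (All; []; _∷_)
import Data.List.Relation.Unary.All.Properties as All
open import Data.List.Relation.Unary.Any as Any using (here; there)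
open import Data.Nat.Base using (ℕ; zero; suc; z≤n; s≤s; ≤′-refl; ≤′-step; _!; NonZero) renaming
  (_+_ to _+ℕ_; _*_ to _*ℕ_; _⊔_ to _⊔ℕ_; _≤_ to _≤ℕ_; _<_ to _<ℕ_; _≤′_ to _≤ℕ′_)
import Data.Nat.Divisibility as ℕ
import Data.Nat.Properties as ℕ
open import Data.Product.Base using (Σ; ∃; ∃-syntax; _×_; _,_; proj₁; proj₂; curry)
open import Data.Rational.Base using (ℚ; 0ℚ; ↥_; ↧ₙ_) renaming (_<_ to _<ℚ_)
open import Data.Sum.Base using (_⊎_; inj₁; inj₂)
open import Data.Unit.Polymorphic.Base using (⊤; tt)
open import Data.Vec.Base using (Vec; []; _∷_; lookup)
open import Function.Base using (_∘_; id)
open import Relation.Binary.PropositionalEquality using (_≡_; refl; sym; trans; cong; cong₂; subst; subst₂)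
open import Relation.Binary.Structures using (IsEquivalence)
open import Relation.Nullary using (Dec; yes; no)
open import Relation.Unary using (Pred; _∪_; ｛_｝)

-- Dividing by gcds takes two reductions, since `e(g,n)` dividing `e(z,n)` does not by itself say
-- that `g` divides `z`: once a common factor `g` of `x` and `y` is split off, the pair `g`, `z` is
-- reduced in turn, and (e8) shows that what is left of `g` contributes only a factor 1. The step
-- from prime divisors to rad(abc) ≤ xyz is an induction along the coded sequence that defines the
-- radical: each partial product divides xyz. For the lower bounds the exponent n - m has to lie in
-- A, or else (e4) says nothing about it; this is where the order axiom of Pr, relativised to A,
-- enters. Multiplying the three bounds gives (xyz)^m ≤ c^3, so the radical contributes at most
-- c^(3(q+p)/m) to the bound on c^q, while 2^m ≤ c turns K into a small power of c as well. Below m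
-- the exponent equals a numeral, so that only powers with external exponents have to be matched
-- with the definable exponential, and their β-codes can be built by recursion outside the model.

private
  variable
    l : Lang
    k m n : ℕ
    ℓ : Level

-- Substitution calculus

renT≡subT : (f : Fin m → Fin n) (t : Term l m) → renT f t ≡ subT (var_ ∘ f) t
renT≡subT f (var i)  = refl
renT≡subT f 0̇        = refl
renT≡subT f 1̇        = refl
renT≡subT f (s +̇ t)  = cong₂ _+̇_ (renT≡subT f s) (renT≡subT f t)
renT≡subT f (s · t)  = cong₂ _·_ (renT≡subT f s) (renT≡subT f t)
renT≡subT f (𝕖 s t)  = cong₂ 𝕖 (renT≡subT f s) (renT≡subT f t)

subT-cong : {σ τ : Fin m → Term l n} → (∀ i → σ i ≡ τ i) → ∀ t → subT σ t ≡ subT τ t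
subT-cong σ≗τ (var i)  = σ≗τ i
subT-cong σ≗τ 0̇        = refl
subT-cong σ≗τ 1̇        = refl
subT-cong σ≗τ (s +̇ t)  = cong₂ _+̇_ (subT-cong σ≗τ s) (subT-cong σ≗τ t)
subT-cong σ≗τ (s · t)  = cong₂ _·_ (subT-cong σ≗τ s) (subT-cong σ≗τ t)
subT-cong σ≗τ (𝕖 s t)  = cong₂ 𝕖 (subT-cong σ≗τ s) (subT-cong σ≗τ t)

subT-id : (t : Term l n) → subT var_ t ≡ t
subT-id (var i)  = refl
subT-id 0̇        = refl
subT-id 1̇        = refl
subT-id (s +̇ t)  = cong₂ _+̇_ (subT-id s) (subT-id t)
subT-id (s · t)  = cong₂ _·_ (subT-id s) (subT-id t)
subT-id (𝕖 s t)  = cong₂ 𝕖 (subT-id s) (subT-id t)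

subT-subT : (τ : Fin m → Term l n) (σ : Fin k → Term l m) (t : Term l k) →
            subT τ (subT σ t) ≡ subT (subT τ ∘ σ) t
subT-subT τ σ (var i)  = refl
subT-subT τ σ 0̇        = refl
subT-subT τ σ 1̇        = refl
subT-subT τ σ (s +̇ t)  = cong₂ _+̇_ (subT-subT τ σ s) (subT-subT τ σ t)
subT-subT τ σ (s · t)  = cong₂ _·_ (subT-subT τ σ s) (subT-subT τ σ t)
subT-subT τ σ (𝕖 s t)  = cong₂ 𝕖 (subT-subT τ σ s) (subT-subT τ σ t)

subT-wk : (τ : Fin (suc m) → Term l n) (t : Term l m) → subT τ (wk 1 t) ≡ subT (τ ∘ suc) t
subT-wk τ t = trans (cong (subT τ) (renT≡subT suc t)) (subT-subT τ (var_ ∘ suc) t)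

wk-subT : (σ : Fin m → Term l n) (t : Term l m) → wk 1 (subT σ t) ≡ subT (wk 1 ∘ σ) t
wk-subT σ t = trans (renT≡subT suc (subT σ t))
  (trans (subT-subT (var_ ∘ suc) σ t) (subT-cong (λ i → sym (renT≡subT suc (σ i))) t))

liftS-cong : {σ τ : Fin m → Term l n} → (∀ i → σ i ≡ τ i) → ∀ i → liftS σ i ≡ liftS τ i
liftS-cong σ≗τ zero    = refl
liftS-cong σ≗τ (suc i) = cong (wk 1) (σ≗τ i)

sub-cong : {σ τ : Fin m → Term l n} → (∀ i → σ i ≡ τ i) → ∀ φ → sub σ φ ≡ sub τ φ
sub-cong σ≗τ ⊥̇        = refl
sub-cong σ≗τ (s ≐ t)  = cong₂ _≐_ (subT-cong σ≗τ s) (subT-cong σ≗τ t)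
sub-cong σ≗τ (s ≤̇ t)  = cong₂ _≤̇_ (subT-cong σ≗τ s) (subT-cong σ≗τ t)
sub-cong σ≗τ (𝔸 t)    = cong 𝔸 (subT-cong σ≗τ t)
sub-cong σ≗τ (φ ⇒ ψ)  = cong₂ _⇒_ (sub-cong σ≗τ φ) (sub-cong σ≗τ ψ)
sub-cong σ≗τ (∀̇ φ)    = cong ∀̇_ (sub-cong (liftS-cong σ≗τ) φ)

ren≡sub : (f : Fin m → Fin n) (φ : Formula l m) → ren f φ ≡ sub (var_ ∘ f) φ
ren≡sub f ⊥̇        = refl
ren≡sub f (s ≐ t)  = cong₂ _≐_ (renT≡subT f s) (renT≡subT f t)
ren≡sub f (s ≤̇ t)  = cong₂ _≤̇_ (renT≡subT f s) (renT≡subT f t)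
ren≡sub f (𝔸 t)    = cong 𝔸 (renT≡subT f t)
ren≡sub f (φ ⇒ ψ)  = cong₂ _⇒_ (ren≡sub f φ) (ren≡sub f ψ)
ren≡sub f (∀̇ φ)    = cong ∀̇_ (trans (ren≡sub (liftR f) φ)
  (sub-cong (λ { zero → refl ; (suc i) → refl }) φ))

sub-sub : (τ : Fin m → Term l n) (σ : Fin k → Term l m) (φ : Formula l k) →
          sub τ (sub σ φ) ≡ sub (subT τ ∘ σ) φ
sub-sub τ σ ⊥̇        = refl
sub-sub τ σ (s ≐ t)  = cong₂ _≐_ (subT-subT τ σ s) (subT-subT τ σ t)
sub-sub τ σ (s ≤̇ t)  = cong₂ _≤̇_ (subT-subT τ σ s) (subT-subT τ σ t)
sub-sub τ σ (𝔸 t)    = cong 𝔸 (subT-subT τ σ t)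
sub-sub τ σ (φ ⇒ ψ)  = cong₂ _⇒_ (sub-sub τ σ φ) (sub-sub τ σ ψ)
sub-sub τ σ (∀̇ φ)    = cong ∀̇_ (trans (sub-sub (liftS τ) (liftS σ) φ) (sub-cong
  (λ { zero → refl ; (suc i) → trans (subT-wk (liftS τ) (σ i)) (sym (wk-subT τ (σ i))) }) φ))

sub-id : (φ : Formula l n) → sub var_ φ ≡ φ
sub-id ⊥̇        = refl
sub-id (s ≐ t)  = cong₂ _≐_ (subT-id s) (subT-id t)
sub-id (s ≤̇ t)  = cong₂ _≤̇_ (subT-id s) (subT-id t)
sub-id (𝔸 t)    = cong 𝔸 (subT-id t)
sub-id (φ ⇒ ψ)  = cong₂ _⇒_ (sub-id φ) (sub-id ψ)
sub-id (∀̇ φ)    = cong ∀̇_ (trans (sub-cong (λ { zero → refl ; (suc i) → refl }) φ) (sub-id φ))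

sub-ren-suc : (τ : Fin (suc m) → Term l n) (φ : Formula l m) → sub τ (ren suc φ) ≡ sub (τ ∘ suc) φ
sub-ren-suc τ φ = trans (cong (sub τ) (ren≡sub suc φ)) (sub-sub τ (var_ ∘ suc) φ)

ren-suc-sub : (σ : Fin m → Term l n) (φ : Formula l m) → ren suc (sub σ φ) ≡ sub (wk 1 ∘ σ) φ
ren-suc-sub σ φ = trans (ren≡sub suc (sub σ φ))
  (trans (sub-sub (var_ ∘ suc) σ φ) (sub-cong (λ i → sym (renT≡subT suc (σ i))) φ))

-- This is the shape in which `∀-elim` and `≐-subst` meet a formula whose free variables have
-- already been substituted.
inst-liftS : (σ : Fin (suc m) → Term l n) (φ : Formula l (suc m)) →
             sub (liftS (σ ∘ suc)) φ [ σ zero ] ≡ sub σ φ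
inst-liftS σ φ = trans (sub-sub (inst (σ zero)) (liftS (σ ∘ suc)) φ) (sub-cong
  (λ { zero → refl ; (suc i) → trans (subT-wk _ (σ (suc i))) (subT-id (σ (suc i))) }) φ)

-- Weakening and ex falso

weaken : {T : Theory l ℓ} {Γ Δ : List (Formula l n)} {φ : Formula l n} →
         Γ ⊆ Δ → T ∣ Γ ⊢ φ → T ∣ Δ ⊢ φ
weaken Γ⊆Δ (axiom Tφ)      = axiom Tφ
weaken Γ⊆Δ (hyp φ∈Γ)       = hyp (Γ⊆Δ φ∈Γ)
weaken Γ⊆Δ (⇒-intro d)     = ⇒-intro (weaken (∷⁺ʳ _ Γ⊆Δ) d)
weaken Γ⊆Δ (⇒-elim d e)    = ⇒-elim (weaken Γ⊆Δ d) (weaken Γ⊆Δ e)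
weaken Γ⊆Δ (raa d)         = raa (weaken (∷⁺ʳ _ Γ⊆Δ) d)
weaken Γ⊆Δ (∀-intro d)     = ∀-intro (weaken (map⁺ _ Γ⊆Δ) d)
weaken Γ⊆Δ (∀-elim d t)    = ∀-elim (weaken Γ⊆Δ d) t
weaken Γ⊆Δ ≐-refl          = ≐-refl
weaken Γ⊆Δ (≐-subst φ d e) = ≐-subst φ (weaken Γ⊆Δ d) (weaken Γ⊆Δ e)

ex-falso : {T : Theory l ℓ} {Γ : List (Formula l n)} {φ : Formula l n} → T ∣ Γ ⊢ ⊥̇ → T ∣ Γ ⊢ φ
ex-falso d = raa (weaken there d)

-- Falsity is interpreted by an arbitrary type, so that the completeness theorem below
-- is constructive; classical reasoning in a structure needs stable atoms only.

record Structure ℓ : Set (lsuc ℓ) where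
  infix  4 _≈_ _≤_
  infixl 6 _+_
  infixl 7 _*_
  field
    D           : Set
    0# 1#       : D
    _+_ _*_ exp : D → D → D
    ⊥           : Set ℓ
    _≈_ _≤_     : D → D → Set ℓ
    A           : D → Set ℓ
    ≈-stable    : ∀ {x y} → ((x ≈ y → ⊥) → ⊥) → x ≈ y
    ≤-stable    : ∀ {x y} → ((x ≤ y → ⊥) → ⊥) → x ≤ y
    A-stable    : ∀ {x} → ((A x → ⊥) → ⊥) → A x
    ≈-equiv     : IsEquivalence _≈_
    +-cong      : ∀ {x x′ y y′} → x ≈ x′ → y ≈ y′ → x + y ≈ x′ + y′
    *-cong      : ∀ {x x′ y y′} → x ≈ x′ → y ≈ y′ → x * y ≈ x′ * y′
    exp-cong    : ∀ {x x′ y y′} → x ≈ x′ → y ≈ y′ → exp x y ≈ exp x′ y′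
    ≤-resp      : ∀ {x x′ y y′} → x ≈ x′ → y ≈ y′ → x ≤ y → x′ ≤ y′
    A-resp      : ∀ {x x′} → x ≈ x′ → A x → A x′

-- Truth in a structure, and soundness

module Semantics {ℓ} (M : Structure ℓ) where
  open Structure M
  open IsEquivalence ≈-equiv public
    renaming (refl to ≈-refl; sym to ≈-sym; trans to ≈-trans; reflexive to ≈-reflexive)

  ⟦_⟧ᵗ : Term l n → Vec D n → D
  ⟦ var i ⟧ᵗ ρ  = lookup ρ i
  ⟦ 0̇ ⟧ᵗ ρ      = 0#
  ⟦ 1̇ ⟧ᵗ ρ      = 1#
  ⟦ s +̇ t ⟧ᵗ ρ  = ⟦ s ⟧ᵗ ρ + ⟦ t ⟧ᵗ ρ
  ⟦ s · t ⟧ᵗ ρ  = ⟦ s ⟧ᵗ ρ * ⟦ t ⟧ᵗ ρ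
  ⟦ 𝕖 s t ⟧ᵗ ρ  = exp (⟦ s ⟧ᵗ ρ) (⟦ t ⟧ᵗ ρ)

  ⟦_⟧ : Formula l n → Vec D n → Set ℓ
  ⟦ ⊥̇ ⟧ ρ      = ⊥
  ⟦ s ≐ t ⟧ ρ  = ⟦ s ⟧ᵗ ρ ≈ ⟦ t ⟧ᵗ ρ
  ⟦ s ≤̇ t ⟧ ρ  = ⟦ s ⟧ᵗ ρ ≤ ⟦ t ⟧ᵗ ρ
  ⟦ 𝔸 t ⟧ ρ    = A (⟦ t ⟧ᵗ ρ)
  ⟦ φ ⇒ ψ ⟧ ρ  = ⟦ φ ⟧ ρ → ⟦ ψ ⟧ ρ
  ⟦ ∀̇ φ ⟧ ρ    = ∀ x → ⟦ φ ⟧ (x ∷ ρ)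

  Models : Theory l ℓ → Set ℓ
  Models T = ∀ {φ} → T φ → ⟦ φ ⟧ []

  stable : (φ : Formula l n) {ρ : Vec D n} → ((⟦ φ ⟧ ρ → ⊥) → ⊥) → ⟦ φ ⟧ ρ
  stable ⊥̇ h        = h id
  stable (s ≐ t) h  = ≈-stable h
  stable (s ≤̇ t) h  = ≤-stable h
  stable (𝔸 t) h    = A-stable h
  stable (φ ⇒ ψ) h  = λ p → stable ψ λ ¬q → h λ f → ¬q (f p)
  stable (∀̇ φ) h    = λ x → stable φ λ ¬q → h λ f → ¬q (f x)

  -- Values agree up to `≈` and not `≡`, because soundness of `≐-subst` compares environments
  -- related only by an equation true in the structure.
  _▹_≋_ : (Fin m → Term l n) → Vec D n → Vec D m → Set ℓ
  σ ▹ ρ ≋ ρ′ = ∀ i → ⟦ σ i ⟧ᵗ ρ ≈ lookup ρ′ i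

  ⟦subT⟧ : {σ : Fin m → Term l n} {ρ : Vec D n} {ρ′ : Vec D m} → σ ▹ ρ ≋ ρ′ →
           ∀ t → ⟦ subT σ t ⟧ᵗ ρ ≈ ⟦ t ⟧ᵗ ρ′
  ⟦subT⟧ r (var i)  = r i
  ⟦subT⟧ r 0̇        = ≈-refl
  ⟦subT⟧ r 1̇        = ≈-refl
  ⟦subT⟧ r (s +̇ t)  = +-cong (⟦subT⟧ r s) (⟦subT⟧ r t)
  ⟦subT⟧ r (s · t)  = *-cong (⟦subT⟧ r s) (⟦subT⟧ r t)
  ⟦subT⟧ r (𝕖 s t)  = exp-cong (⟦subT⟧ r s) (⟦subT⟧ r t)

  ⟦wk⟧ : ∀ (t : Term l n) {x ρ} → ⟦ wk 1 t ⟧ᵗ (x ∷ ρ) ≈ ⟦ t ⟧ᵗ ρ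
  ⟦wk⟧ t {x} {ρ} = ≈-trans (≈-reflexive (cong (λ u → ⟦ u ⟧ᵗ (x ∷ ρ)) (renT≡subT suc t)))
    (⟦subT⟧ (λ _ → ≈-refl) t)

  ≋-lift : {σ : Fin m → Term l n} {ρ : Vec D n} {ρ′ : Vec D m} → σ ▹ ρ ≋ ρ′ →
           ∀ {x} → liftS σ ▹ (x ∷ ρ) ≋ (x ∷ ρ′)
  ≋-lift r zero            = ≈-refl
  ≋-lift {σ = σ} r (suc i) = ≈-trans (⟦wk⟧ (σ i)) (r i)

  ⟦sub⟧⇒ : {σ : Fin m → Term l n} {ρ : Vec D n} {ρ′ : Vec D m} → σ ▹ ρ ≋ ρ′ →
           ∀ φ → ⟦ sub σ φ ⟧ ρ → ⟦ φ ⟧ ρ′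
  ⟦sub⟧⇐ : {σ : Fin m → Term l n} {ρ : Vec D n} {ρ′ : Vec D m} → σ ▹ ρ ≋ ρ′ →
           ∀ φ → ⟦ φ ⟧ ρ′ → ⟦ sub σ φ ⟧ ρ
  ⟦sub⟧⇒ r ⊥̇ h        = h
  ⟦sub⟧⇒ r (s ≐ t) h  = ≈-trans (≈-sym (⟦subT⟧ r s)) (≈-trans h (⟦subT⟧ r t))
  ⟦sub⟧⇒ r (s ≤̇ t) h  = ≤-resp (⟦subT⟧ r s) (⟦subT⟧ r t) h
  ⟦sub⟧⇒ r (𝔸 t) h    = A-resp (⟦subT⟧ r t) h
  ⟦sub⟧⇒ r (φ ⇒ ψ) h  = λ p → ⟦sub⟧⇒ r ψ (h (⟦sub⟧⇐ r φ p))
  ⟦sub⟧⇒ r (∀̇ φ) h    = λ x → ⟦sub⟧⇒ (≋-lift r) φ (h x)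
  ⟦sub⟧⇐ r ⊥̇ h        = h
  ⟦sub⟧⇐ r (s ≐ t) h  = ≈-trans (⟦subT⟧ r s) (≈-trans h (≈-sym (⟦subT⟧ r t)))
  ⟦sub⟧⇐ r (s ≤̇ t) h  = ≤-resp (≈-sym (⟦subT⟧ r s)) (≈-sym (⟦subT⟧ r t)) h
  ⟦sub⟧⇐ r (𝔸 t) h    = A-resp (≈-sym (⟦subT⟧ r t)) h
  ⟦sub⟧⇐ r (φ ⇒ ψ) h  = λ p → ⟦sub⟧⇐ r ψ (h (⟦sub⟧⇒ r φ p))
  ⟦sub⟧⇐ r (∀̇ φ) h    = λ x → ⟦sub⟧⇐ (≋-lift r) φ (h x)

  ⟦ren⟧⇐ : {f : Fin m → Fin n} {ρ : Vec D n} {ρ′ : Vec D m} → (var_ {l} ∘ f) ▹ ρ ≋ ρ′ →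
           ∀ (φ : Formula l m) → ⟦ φ ⟧ ρ′ → ⟦ ren f φ ⟧ ρ
  ⟦ren⟧⇐ {f = f} r φ h = subst (λ ψ → ⟦ ψ ⟧ _) (sym (ren≡sub f φ)) (⟦sub⟧⇐ r φ h)

  inst-≋ : (t : Term l n) (ρ : Vec D n) → inst t ▹ ρ ≋ (⟦ t ⟧ᵗ ρ ∷ ρ)
  inst-≋ t ρ zero    = ≈-refl
  inst-≋ t ρ (suc i) = ≈-refl

  ⟦ren-suc⟧ : {Γ : List (Formula l n)} {ρ : Vec D n} → ∀ x →
              All (λ φ → ⟦ φ ⟧ ρ) Γ → All (λ φ → ⟦ φ ⟧ (x ∷ ρ)) (map (ren suc) Γ)
  ⟦ren-suc⟧ x []                = []
  ⟦ren-suc⟧ x (_∷_ {x = φ} p ps) = ⟦ren⟧⇐ (λ _ → ≈-refl) φ p ∷ ⟦ren-suc⟧ x ps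

  soundness : {T : Theory l ℓ} → Models T → {Γ : List (Formula l n)} {φ : Formula l n} →
              T ∣ Γ ⊢ φ → ∀ {ρ} → All (λ ψ → ⟦ ψ ⟧ ρ) Γ → ⟦ φ ⟧ ρ
  soundness MT (axiom {φ = φ} Tφ) γ = ⟦ren⟧⇐ (λ ()) φ (MT Tφ)
  soundness MT (hyp φ∈Γ) γ = All.lookup γ φ∈Γ
  soundness MT (⇒-intro d) γ = λ p → soundness MT d (p ∷ γ)
  soundness MT (⇒-elim d e) γ = soundness MT d γ (soundness MT e γ)
  soundness MT (raa {φ = φ} d) γ = stable φ λ ¬p → soundness MT d (¬p ∷ γ)
  soundness MT (∀-intro d) γ = λ x → soundness MT d (⟦ren-suc⟧ x γ)
  soundness MT (∀-elim {φ = φ} d t) {ρ} γ = ⟦sub⟧⇐ (inst-≋ t ρ) φ (soundness MT d γ _)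
  soundness MT ≐-refl γ = ≈-refl
  soundness MT (≐-subst {s = s} {t} φ d e) {ρ} γ =
    ⟦sub⟧⇐ {ρ′ = ⟦ s ⟧ᵗ ρ ∷ ρ} t≋s φ (⟦sub⟧⇒ (inst-≋ s ρ) φ (soundness MT e γ))
    where
    t≋s : inst t ▹ ρ ≋ (⟦ s ⟧ᵗ ρ ∷ ρ)
    t≋s zero    = ≈-sym (soundness MT d γ)
    t≋s (suc i) = ≈-refl

  ⟦closure⟧ : (φ : Formula l n) → ⟦ closure φ ⟧ [] → ∀ ρ → ⟦ φ ⟧ ρ
  ⟦closure⟧ {n = zero}  φ h []      = h
  ⟦closure⟧ {n = suc n} φ h (x ∷ ρ) = ⟦closure⟧ (∀̇ φ) h ρ x

  ⟦embedT⟧ : (t : Term L n) (ρ : Vec D n) → ⟦ embedT t ⟧ᵗ ρ ≡ ⟦ t ⟧ᵗ ρ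
  ⟦embedT⟧ (var i) ρ  = refl
  ⟦embedT⟧ 0̇ ρ        = refl
  ⟦embedT⟧ 1̇ ρ        = refl
  ⟦embedT⟧ (s +̇ t) ρ  = cong₂ _+_ (⟦embedT⟧ s ρ) (⟦embedT⟧ t ρ)
  ⟦embedT⟧ (s · t) ρ  = cong₂ _*_ (⟦embedT⟧ s ρ) (⟦embedT⟧ t ρ)

  ⟦embed⟧⇒ : (φ : Formula L n) {ρ : Vec D n} → ⟦ embed φ ⟧ ρ → ⟦ φ ⟧ ρ
  ⟦embed⟧⇐ : (φ : Formula L n) {ρ : Vec D n} → ⟦ φ ⟧ ρ → ⟦ embed φ ⟧ ρ
  ⟦embed⟧⇒ ⊥̇ h                = h
  ⟦embed⟧⇒ (s ≐ t) {ρ} h      = subst₂ _≈_ (⟦embedT⟧ s ρ) (⟦embedT⟧ t ρ) h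
  ⟦embed⟧⇒ (s ≤̇ t) {ρ} h      = subst₂ _≤_ (⟦embedT⟧ s ρ) (⟦embedT⟧ t ρ) h
  ⟦embed⟧⇒ (φ ⇒ ψ) h          = λ p → ⟦embed⟧⇒ ψ (h (⟦embed⟧⇐ φ p))
  ⟦embed⟧⇒ (∀̇ φ) h            = λ x → ⟦embed⟧⇒ φ (h x)
  ⟦embed⟧⇐ ⊥̇ h                = h
  ⟦embed⟧⇐ (s ≐ t) {ρ} h      = subst₂ _≈_ (sym (⟦embedT⟧ s ρ)) (sym (⟦embedT⟧ t ρ)) h
  ⟦embed⟧⇐ (s ≤̇ t) {ρ} h      = subst₂ _≤_ (sym (⟦embedT⟧ s ρ)) (sym (⟦embedT⟧ t ρ)) h
  ⟦embed⟧⇐ (φ ⇒ ψ) h          = λ p → ⟦embed⟧⇐ ψ (h (⟦embed⟧⇒ φ p))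
  ⟦embed⟧⇐ (∀̇ φ) h            = λ x → ⟦embed⟧⇐ φ (h x)

-- Henkin completeness

-- Terms over countably many parameters, and formulas with such terms for their free
-- variables. A parameter is interpreted by a term of arbitrary scope, so that neither
-- scopes nor derivations have to be renamed when fresh parameters come in.

data Tm : Set where
  par         : ℕ → Tm
  zeroᵖ oneᵖ  : Tm
  _+ᵖ_ _*ᵖ_ expᵖ : Tm → Tm → Tm

infix 6 _⟨_⟩

data Code : Set where
  _⟨_⟩ : Formula Lᵉ n → Vec Tm n → Code

_⟪_⟫ᵗ : Tm → (ℕ → Term Lᵉ n) → Term Lᵉ n
par i ⟪ σ ⟫ᵗ     = σ i
zeroᵖ ⟪ σ ⟫ᵗ     = 0̇
oneᵖ ⟪ σ ⟫ᵗ      = 1̇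
(s +ᵖ t) ⟪ σ ⟫ᵗ  = s ⟪ σ ⟫ᵗ +̇ t ⟪ σ ⟫ᵗ
(s *ᵖ t) ⟪ σ ⟫ᵗ  = s ⟪ σ ⟫ᵗ · t ⟪ σ ⟫ᵗ
expᵖ s t ⟪ σ ⟫ᵗ  = 𝕖 (s ⟪ σ ⟫ᵗ) (t ⟪ σ ⟫ᵗ)

_⟪_⟫ˢ : Vec Tm m → (ℕ → Term Lᵉ n) → Fin m → Term Lᵉ n
(ρ ⟪ σ ⟫ˢ) i = lookup ρ i ⟪ σ ⟫ᵗ

_⟪_⟫ : Code → (ℕ → Term Lᵉ n) → Formula Lᵉ n
(φ ⟨ ρ ⟩) ⟪ σ ⟫ = sub (ρ ⟪ σ ⟫ˢ) φ

boundᵗ : Tm → ℕ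
boundᵗ (par i)    = suc i
boundᵗ zeroᵖ      = 0
boundᵗ oneᵖ       = 0
boundᵗ (s +ᵖ t)   = boundᵗ s ⊔ℕ boundᵗ t
boundᵗ (s *ᵖ t)   = boundᵗ s ⊔ℕ boundᵗ t
boundᵗ (expᵖ s t) = boundᵗ s ⊔ℕ boundᵗ t

boundᵛ : Vec Tm n → ℕ
boundᵛ []      = 0
boundᵛ (t ∷ ρ) = boundᵗ t ⊔ℕ boundᵛ ρ

bound : Code → ℕ
bound (φ ⟨ ρ ⟩) = boundᵛ ρ

private
  module _ {P : ℕ → Set} {a b : ℕ} where
    ⊔ˡ : (∀ {i} → i <ℕ a ⊔ℕ b → P i) → ∀ {i} → i <ℕ a → P i
    ⊔ˡ h i<a = h (ℕ.<-≤-trans i<a (ℕ.m≤m⊔n a b))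
    ⊔ʳ : (∀ {i} → i <ℕ a ⊔ℕ b → P i) → ∀ {i} → i <ℕ b → P i
    ⊔ʳ h i<b = h (ℕ.<-≤-trans i<b (ℕ.m≤n⊔m a b))

⟪⟫ᵗ-wk : {σ : ℕ → Term Lᵉ n} {τ : ℕ → Term Lᵉ (suc n)} (t : Tm) →
         (∀ {i} → i <ℕ boundᵗ t → τ i ≡ wk 1 (σ i)) → t ⟪ τ ⟫ᵗ ≡ wk 1 (t ⟪ σ ⟫ᵗ)
⟪⟫ᵗ-wk (par i) h    = h ℕ.≤-refl
⟪⟫ᵗ-wk zeroᵖ h      = refl
⟪⟫ᵗ-wk oneᵖ h       = refl
⟪⟫ᵗ-wk (s +ᵖ t) h   = cong₂ _+̇_ (⟪⟫ᵗ-wk s (⊔ˡ h)) (⟪⟫ᵗ-wk t (⊔ʳ {a = boundᵗ s} h))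
⟪⟫ᵗ-wk (s *ᵖ t) h   = cong₂ _·_ (⟪⟫ᵗ-wk s (⊔ˡ h)) (⟪⟫ᵗ-wk t (⊔ʳ {a = boundᵗ s} h))
⟪⟫ᵗ-wk (expᵖ s t) h = cong₂ 𝕖 (⟪⟫ᵗ-wk s (⊔ˡ h)) (⟪⟫ᵗ-wk t (⊔ʳ {a = boundᵗ s} h))

⟪⟫ˢ-wk : {σ : ℕ → Term Lᵉ n} {τ : ℕ → Term Lᵉ (suc n)} (ρ : Vec Tm m) →
         (∀ {i} → i <ℕ boundᵛ ρ → τ i ≡ wk 1 (σ i)) → ∀ i → (ρ ⟪ τ ⟫ˢ) i ≡ wk 1 ((ρ ⟪ σ ⟫ˢ) i)
⟪⟫ˢ-wk (t ∷ ρ) h zero    = ⟪⟫ᵗ-wk t (⊔ˡ h)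
⟪⟫ˢ-wk (t ∷ ρ) h (suc i) = ⟪⟫ˢ-wk ρ (⊔ʳ {a = boundᵗ t} h) i

⟪⟫-wk : {σ : ℕ → Term Lᵉ n} {τ : ℕ → Term Lᵉ (suc n)} (c : Code) →
        (∀ {i} → i <ℕ bound c → τ i ≡ wk 1 (σ i)) → c ⟪ τ ⟫ ≡ ren suc (c ⟪ σ ⟫)
⟪⟫-wk (φ ⟨ ρ ⟩) h = trans (sub-cong (⟪⟫ˢ-wk ρ h) φ) (sym (ren-suc-sub _ φ))

⟪⟫-∀ : (φ : Formula Lᵉ (suc n)) (t : Tm) (ρ : Vec Tm n) (σ : ℕ → Term Lᵉ m) →
       sub (liftS (ρ ⟪ σ ⟫ˢ)) φ [ t ⟪ σ ⟫ᵗ ] ≡ (φ ⟨ t ∷ ρ ⟩) ⟪ σ ⟫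
⟪⟫-∀ φ t ρ σ = inst-liftS ((t ∷ ρ) ⟪ σ ⟫ˢ) φ

-- Enumeration of the codes by height

heightᵗ : Term Lᵉ n → ℕ
heightᵗ (var i)  = 1
heightᵗ 0̇        = 1
heightᵗ 1̇        = 1
heightᵗ (s +̇ t)  = suc (heightᵗ s ⊔ℕ heightᵗ t)
heightᵗ (s · t)  = suc (heightᵗ s ⊔ℕ heightᵗ t)
heightᵗ (𝕖 s t)  = suc (heightᵗ s ⊔ℕ heightᵗ t)

height : Formula Lᵉ n → ℕ
height ⊥̇        = 1
height (s ≐ t)  = suc (heightᵗ s ⊔ℕ heightᵗ t)
height (s ≤̇ t)  = suc (heightᵗ s ⊔ℕ heightᵗ t)
height (𝔸 t)    = suc (heightᵗ t)
height (φ ⇒ ψ)  = suc (height φ ⊔ℕ height ψ)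
height (∀̇ φ)    = suc (height φ)

heightᵖ : Tm → ℕ
-- Two more than `i`, as `tms (suc h)` lists only the parameters below `h`.
heightᵖ (par i)    = suc (suc i)
heightᵖ zeroᵖ      = 1
heightᵖ oneᵖ       = 1
heightᵖ (s +ᵖ t)   = suc (heightᵖ s ⊔ℕ heightᵖ t)
heightᵖ (s *ᵖ t)   = suc (heightᵖ s ⊔ℕ heightᵖ t)
heightᵖ (expᵖ s t) = suc (heightᵖ s ⊔ℕ heightᵖ t)

heightᵛ : Vec Tm n → ℕ
heightᵛ []      = 0
heightᵛ (t ∷ ρ) = heightᵖ t ⊔ℕ heightᵛ ρ

-- Arity counts towards the height, so that finitely many codes lie below each height; `suc n`
-- because `upTo h` stops before `h`.
heightᶜ : Code → ℕ
heightᶜ (_⟨_⟩ {n} φ ρ) = suc n ⊔ℕ (height φ ⊔ℕ heightᵛ ρ)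

terms : ℕ → ∀ n → List (Term Lᵉ n)
terms zero    n = []
terms (suc h) n = map var_ (allFin n) ++ 0̇ ∷ 1̇ ∷ pairs _+̇_ ++ pairs _·_ ++ pairs 𝕖
  where pairs = λ f → cartesianProductWith f (terms h n) (terms h n)

formulas : ℕ → ∀ n → List (Formula Lᵉ n)
formulas zero    n = []
formulas (suc h) n = ⊥̇ ∷ atoms _≐_ ++ atoms _≤̇_ ++ map 𝔸 (terms h n) ++
  cartesianProductWith _⇒_ (formulas h n) (formulas h n) ++ map ∀̇_ (formulas h (suc n))
  where atoms = λ f → cartesianProductWith f (terms h n) (terms h n)

tms : ℕ → List Tm
tms zero    = []
tms (suc h) = map par (upTo h) ++ zeroᵖ ∷ oneᵖ ∷ pairs _+ᵖ_ ++ pairs _*ᵖ_ ++ pairs expᵖ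
  where pairs = λ f → cartesianProductWith f (tms h) (tms h)

vecs : ℕ → ∀ n → List (Vec Tm n)
vecs h zero    = [] ∷ []
vecs h (suc n) = cartesianProductWith _∷_ (tms h) (vecs h n)

codesOfArity : ℕ → ℕ → List Code
codesOfArity h n = cartesianProductWith _⟨_⟩ (formulas h n) (vecs h n)

codes : ℕ → List Code
codes h = concatMap (codesOfArity h) (upTo h)

terms-complete : ∀ {h} (t : Term Lᵉ n) → heightᵗ t ≤ℕ h → t ∈ terms h n
terms-complete (var i) (s≤s _) = ∈-++⁺ˡ (∈-map⁺ var_ (∈-allFin i))
terms-complete 0̇ (s≤s _)       = ∈-++⁺ʳ (map var_ _) (here refl)
terms-complete 1̇ (s≤s _)       = ∈-++⁺ʳ (map var_ _) (there (here refl))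
terms-complete (s +̇ t) (s≤s p) = ∈-++⁺ʳ (map var_ _) (there (there (∈-++⁺ˡ
  (∈-cartesianProductWith⁺ _+̇_ (terms-complete s (ℕ.m⊔n≤o⇒m≤o _ _ p)) (terms-complete t (ℕ.m⊔n≤o⇒n≤o _ _ p))))))
terms-complete {n} {suc h} (s · t) (s≤s p) = ∈-++⁺ʳ (map var_ _) (there (there (∈-++⁺ʳ
  (cartesianProductWith _+̇_ (terms h n) (terms h n)) (∈-++⁺ˡ
  (∈-cartesianProductWith⁺ _·_ (terms-complete s (ℕ.m⊔n≤o⇒m≤o _ _ p)) (terms-complete t (ℕ.m⊔n≤o⇒n≤o _ _ p)))))))
terms-complete {n} {suc h} (𝕖 s t) (s≤s p) = ∈-++⁺ʳ (map var_ _) (there (there (∈-++⁺ʳ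
  (cartesianProductWith _+̇_ (terms h n) (terms h n)) (∈-++⁺ʳ (cartesianProductWith _·_ (terms h n) (terms h n))
  (∈-cartesianProductWith⁺ 𝕖 (terms-complete s (ℕ.m⊔n≤o⇒m≤o _ _ p)) (terms-complete t (ℕ.m⊔n≤o⇒n≤o _ _ p)))))))

formulas-complete : ∀ {h} (φ : Formula Lᵉ n) → height φ ≤ℕ h → φ ∈ formulas h n
formulas-complete ⊥̇ (s≤s _)       = here refl
formulas-complete (s ≐ t) (s≤s p) = there (∈-++⁺ˡ
  (∈-cartesianProductWith⁺ _≐_ (terms-complete s (ℕ.m⊔n≤o⇒m≤o _ _ p)) (terms-complete t (ℕ.m⊔n≤o⇒n≤o _ _ p))))
formulas-complete {n} {suc h} (s ≤̇ t) (s≤s p) = there (∈-++⁺ʳ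
  (cartesianProductWith _≐_ (terms h n) (terms h n)) (∈-++⁺ˡ
  (∈-cartesianProductWith⁺ _≤̇_ (terms-complete s (ℕ.m⊔n≤o⇒m≤o _ _ p)) (terms-complete t (ℕ.m⊔n≤o⇒n≤o _ _ p)))))
formulas-complete {n} {suc h} (𝔸 t) (s≤s p) = there (∈-++⁺ʳ
  (cartesianProductWith _≐_ (terms h n) (terms h n)) (∈-++⁺ʳ
  (cartesianProductWith _≤̇_ (terms h n) (terms h n)) (∈-++⁺ˡ (∈-map⁺ 𝔸 (terms-complete t p)))))
formulas-complete {n} {suc h} (φ ⇒ ψ) (s≤s p) = there (∈-++⁺ʳ
  (cartesianProductWith _≐_ (terms h n) (terms h n)) (∈-++⁺ʳ
  (cartesianProductWith _≤̇_ (terms h n) (terms h n)) (∈-++⁺ʳ (map 𝔸 (terms h n)) (∈-++⁺ˡ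
  (∈-cartesianProductWith⁺ _⇒_ (formulas-complete φ (ℕ.m⊔n≤o⇒m≤o _ _ p))
    (formulas-complete ψ (ℕ.m⊔n≤o⇒n≤o _ _ p)))))))
formulas-complete {n} {suc h} (∀̇ φ) (s≤s p) = there (∈-++⁺ʳ
  (cartesianProductWith _≐_ (terms h n) (terms h n)) (∈-++⁺ʳ
  (cartesianProductWith _≤̇_ (terms h n) (terms h n)) (∈-++⁺ʳ (map 𝔸 (terms h n)) (∈-++⁺ʳ
  (cartesianProductWith _⇒_ (formulas h n) (formulas h n)) (∈-map⁺ ∀̇_ (formulas-complete φ p))))))

tms-complete : ∀ {h} (t : Tm) → heightᵖ t ≤ℕ h → t ∈ tms h
tms-complete (par i) (s≤s p)   = ∈-++⁺ˡ (∈-map⁺ par (∈-upTo⁺ p))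
tms-complete zeroᵖ (s≤s _)     = ∈-++⁺ʳ (map par _) (here refl)
tms-complete oneᵖ (s≤s _)      = ∈-++⁺ʳ (map par _) (there (here refl))
tms-complete (s +ᵖ t) (s≤s p) = ∈-++⁺ʳ (map par _) (there (there (∈-++⁺ˡ
  (∈-cartesianProductWith⁺ _+ᵖ_ (tms-complete s (ℕ.m⊔n≤o⇒m≤o _ _ p)) (tms-complete t (ℕ.m⊔n≤o⇒n≤o _ _ p))))))
tms-complete {suc h} (s *ᵖ t) (s≤s p) = ∈-++⁺ʳ (map par _) (there (there (∈-++⁺ʳ
  (cartesianProductWith _+ᵖ_ (tms h) (tms h)) (∈-++⁺ˡ
  (∈-cartesianProductWith⁺ _*ᵖ_ (tms-complete s (ℕ.m⊔n≤o⇒m≤o _ _ p)) (tms-complete t (ℕ.m⊔n≤o⇒n≤o _ _ p)))))))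
tms-complete {suc h} (expᵖ s t) (s≤s p) = ∈-++⁺ʳ (map par _) (there (there (∈-++⁺ʳ
  (cartesianProductWith _+ᵖ_ (tms h) (tms h)) (∈-++⁺ʳ (cartesianProductWith _*ᵖ_ (tms h) (tms h))
  (∈-cartesianProductWith⁺ expᵖ (tms-complete s (ℕ.m⊔n≤o⇒m≤o _ _ p)) (tms-complete t (ℕ.m⊔n≤o⇒n≤o _ _ p)))))))

vecs-complete : ∀ {h} (ρ : Vec Tm n) → heightᵛ ρ ≤ℕ h → ρ ∈ vecs h n
vecs-complete []      _ = here refl
vecs-complete (t ∷ ρ) p = ∈-cartesianProductWith⁺ _∷_
  (tms-complete t (ℕ.m⊔n≤o⇒m≤o _ _ p)) (vecs-complete ρ (ℕ.m⊔n≤o⇒n≤o _ _ p))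

codes-complete : ∀ c → c ∈ codes (heightᶜ c)
codes-complete (_⟨_⟩ {n} φ ρ) = ∈-concatMap⁺ (codesOfArity (suc n ⊔ℕ h))
  (Any.map (λ { refl → φ⟨ρ⟩∈ }) (∈-upTo⁺ {suc n ⊔ℕ h} {n} (ℕ.m≤m⊔n (suc n) h)))
  where
  h = height φ ⊔ℕ heightᵛ ρ
  φ⟨ρ⟩∈ : φ ⟨ ρ ⟩ ∈ codesOfArity (suc n ⊔ℕ h) n
  φ⟨ρ⟩∈ = ∈-cartesianProductWith⁺ _⟨_⟩
    (formulas-complete φ (ℕ.m⊔n≤o⇒m≤o _ _ (ℕ.m≤n⊔m (suc n) h)))
    (vecs-complete ρ (ℕ.m⊔n≤o⇒n≤o _ _ (ℕ.m≤n⊔m (suc n) h)))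

-- Henkin theory and term model

module Henkin {ℓ} (T : Theory Lᵉ ℓ) (goal : Sentence Lᵉ) where

  infix 2 _⊩_ _⊫_

  -- Uniformity in `σ` makes the parameters act as constants foreign to `T`: replacing one of them
  -- by a fresh variable is a mere change of `σ`.
  _⊩_ : List Code → Code → Set ℓ
  Γ ⊩ c = ∀ {n} (σ : ℕ → Term Lᵉ n) → T ∣ map (_⟪ σ ⟫) Γ ⊢ c ⟪ σ ⟫

  _⊫_ : Pred Code ℓ → Code → Set ℓ
  G ⊫ c = ∃ λ Γ → All G Γ × (Γ ⊩ c)

  ⊥ᶜ : Code
  ⊥ᶜ = ⊥̇ ⟨ [] ⟩

  ⊩-weaken : ∀ {Γ Δ c} → Γ ⊆ Δ → Γ ⊩ c → Δ ⊩ c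
  ⊩-weaken Γ⊆Δ d σ = weaken (map⁺ _ Γ⊆Δ) (d σ)

  ⊫-mono : ∀ {G G′ c} → (∀ {d} → G d → G′ d) → G ⊫ c → G′ ⊫ c
  ⊫-mono G⊆G′ (Γ , γ , d) = Γ , All.map G⊆G′ γ , d

  -- Any code with a nonempty environment can stand for a universal one, as ∀̇ φ does not
  -- depend on the first entry.
  witness : ℕ → Code → Code
  witness j (φ ⟨ [] ⟩)    = (⊥̇ ⇒ ⊥̇) ⟨ [] ⟩
  witness j (φ ⟨ t ∷ ρ ⟩) = (φ ⇒ ren suc (∀̇ φ)) ⟨ par j ∷ ρ ⟩

  -- If `Γ` refutes φ(j) ⇒ ∀φ, then it proves φ(j), since ¬φ(j) would yield the implication. As
  -- `par j` is fresh, `τ` may send it to a new variable, and generalising gives ∀φ; but this also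
  -- yields the implication.
  witness-conservative : ∀ {Γ} j c → bound c ≤ℕ j → All (λ d → bound d ≤ℕ j) Γ →
                         witness j c ∷ Γ ⊩ ⊥ᶜ → Γ ⊩ ⊥ᶜ
  witness-conservative j (φ ⟨ [] ⟩) _ _ d σ = ⇒-elim (⇒-intro (d σ)) (⇒-intro (hyp (here refl)))
  witness-conservative {Γ} j (φ ⟨ t ∷ ρ ⟩) c≤j Γ≤j d σ =
    ⇒-elim (⇒-intro (d σ)) (⇒-intro (weaken there
      (subst (T ∣ map (_⟪ σ ⟫) Γ ⊢_) (sym (sub-ren-suc _ (∀̇ φ))) ∀φ)))
    where
    pick : ∀ i → Dec (i ≡ j) → Term Lᵉ _
    pick i (yes _) = v₀
    pick i (no _)  = wk 1 (σ i)
    τ : ℕ → Term Lᵉ _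
    τ i = pick i (i ℕ.≟ j)
    τj : τ j ≡ v₀
    τj with j ℕ.≟ j
    ... | yes _  = refl
    ... | no j≢j = ⊥-elim (j≢j refl)
    τ< : ∀ {i} → i <ℕ j → τ i ≡ wk 1 (σ i)
    τ< {i} i<j with i ℕ.≟ j
    ... | yes refl = ⊥-elim (ℕ.<-irrefl refl i<j)
    ... | no _     = refl
    Γτ : ∀ {Γ} → All (λ d → bound d ≤ℕ j) Γ → map (_⟪ τ ⟫) Γ ≡ map (ren suc) (map (_⟪ σ ⟫) Γ)
    Γτ []                  = refl
    Γτ (_∷_ {x = d} p ps)  = cong₂ _∷_ (⟪⟫-wk d λ i<d → τ< (ℕ.<-≤-trans i<d p)) (Γτ ps)
    φτ : (φ ⟨ par j ∷ ρ ⟩) ⟪ τ ⟫ ≡ sub (liftS (ρ ⟪ σ ⟫ˢ)) φ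
    φτ = sub-cong (λ { zero    → τj
                     ; (suc i) → ⟪⟫ˢ-wk ρ (λ i<ρ → τ< (ℕ.<-≤-trans i<ρ (ℕ.m⊔n≤o⇒n≤o (boundᵗ t) _ c≤j))) i }) φ
    φx : T ∣ map (_⟪ τ ⟫) Γ ⊢ (φ ⟨ par j ∷ ρ ⟩) ⟪ τ ⟫
    φx = raa (⇒-elim (weaken there (⇒-intro (d τ)))
               (⇒-intro (ex-falso (⇒-elim (hyp (there (here refl))) (hyp (here refl))))))
    ∀φ : T ∣ map (_⟪ σ ⟫) Γ ⊢ ((∀̇ φ) ⟨ ρ ⟩) ⟪ σ ⟫
    ∀φ = ∀-intro (subst₂ (T ∣_⊢_) (Γτ Γ≤j) φτ φx)

  Equiconsistent : Pred Code ℓ → Pred Code ℓ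
  Equiconsistent G c = ∀ {Γ} → All G Γ → c ∷ Γ ⊩ ⊥ᶜ → G ⊫ ⊥ᶜ

  -- All parameters of a stage lie below its level; the `suc` pays for the new parameter in the
  -- witness of `c`.
  level : List Code → ℕ
  level []       = 0
  level (c ∷ cs) = suc (bound c ⊔ℕ level cs)

  -- Equiconsistency being undecidable, the stages are predicates instead of lists.
  Stage : List Code → Pred Code ℓ
  Stage []       d = Lift ℓ (d ≡ (¬̇ goal) ⟨ [] ⟩)
  Stage (c ∷ cs) d = Stage cs d ⊎ (d ≡ c × Equiconsistent (Stage cs) c)
                                ⊎ Lift ℓ (d ≡ witness (bound c ⊔ℕ level cs) c)

  bound-witness : ∀ {j} c → bound c ≤ℕ j → bound (witness j c) ≤ℕ suc j
  bound-witness (φ ⟨ [] ⟩) p    = z≤n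
  bound-witness (φ ⟨ t ∷ ρ ⟩) p = ℕ.⊔-lub ℕ.≤-refl (ℕ.m≤n⇒m≤1+n (ℕ.m⊔n≤o⇒n≤o (boundᵗ t) _ p))

  stage-bound : ∀ cs {d} → Stage cs d → bound d ≤ℕ level cs
  stage-bound [] (lift refl)                  = z≤n
  stage-bound (c ∷ cs) (inj₁ d∈cs)            =
    ℕ.m≤n⇒m≤1+n (ℕ.≤-trans (stage-bound cs d∈cs) (ℕ.m≤n⊔m (bound c) _))
  stage-bound (c ∷ cs) (inj₂ (inj₁ (refl , _))) = ℕ.m≤n⇒m≤1+n (ℕ.m≤m⊔n (bound c) _)
  stage-bound (c ∷ cs) (inj₂ (inj₂ (lift refl))) = bound-witness c (ℕ.m≤m⊔n (bound c) _)

  -- Contracts all uses of `c` in a derivation to a single hypothesis, and keeps the evidence `P`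
  -- that came with one of them.
  extract : ∀ {G : Pred Code ℓ} {P : Set ℓ} {c} Γ → All (λ d → G d ⊎ (d ≡ c × P)) Γ →
            All G Γ ⊎ P × (∃ λ Δ → All G Δ × Γ ⊆ c ∷ Δ)
  extract []      []                     = inj₁ []
  extract (d ∷ Γ) (inj₁ g ∷ γ) with extract Γ γ
  ... | inj₁ γ′                 = inj₁ (g ∷ γ′)
  ... | inj₂ (p , Δ , δ , Γ⊆)   = inj₂ (p , d ∷ Δ , g ∷ δ ,
    λ { (here refl) → there (here refl) ; (there e∈Γ) → ∷⁺ʳ _ there (Γ⊆ e∈Γ) })
  extract (d ∷ Γ) (inj₂ (refl , p) ∷ γ) with extract Γ γ
  ... | inj₁ γ′                 = inj₂ (p , Γ , γ′ , id)
  ... | inj₂ (_ , Δ , δ , Γ⊆)   = inj₂ (p , Δ , δ , λ { (here e) → here e ; (there e∈Γ) → Γ⊆ e∈Γ })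

  -- The witness is removed first, as its parameter is fresh for `c` too; then `c` is removed by the
  -- equiconsistency that accompanies its membership.
  stage-conservative : ∀ c cs → Stage (c ∷ cs) ⊫ ⊥ᶜ → Stage cs ⊫ ⊥ᶜ
  stage-conservative c cs (Γ , γ , d) = drop-c (drop-witness (extract Γ (All.map assoc γ)))
    where
    j = bound c ⊔ℕ level cs
    G : Pred Code ℓ
    G d = Stage cs d ⊎ (d ≡ c × Equiconsistent (Stage cs) c)
    assoc : ∀ {d} → Stage (c ∷ cs) d → G d ⊎ (d ≡ witness j c × ⊤)
    assoc (inj₁ p)                = inj₁ (inj₁ p)
    assoc (inj₂ (inj₁ p))         = inj₁ (inj₂ p)
    assoc (inj₂ (inj₂ (lift p)))  = inj₂ (p , tt)
    bounded : ∀ {d} → G d → bound d ≤ℕ j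
    bounded (inj₁ p)          = ℕ.≤-trans (stage-bound cs p) (ℕ.m≤n⊔m (bound c) _)
    bounded (inj₂ (refl , _)) = ℕ.m≤m⊔n (bound c) _
    drop-witness : All G Γ ⊎ ⊤ × (∃ λ Δ → All G Δ × Γ ⊆ witness j c ∷ Δ) → G ⊫ ⊥ᶜ
    drop-witness (inj₁ γ′)               = Γ , γ′ , d
    drop-witness (inj₂ (_ , Δ , δ , Γ⊆)) = Δ , δ ,
      witness-conservative j c (ℕ.m≤m⊔n (bound c) _) (All.map bounded δ) (⊩-weaken {c = ⊥ᶜ} Γ⊆ d)
    drop-c : G ⊫ ⊥ᶜ → Stage cs ⊫ ⊥ᶜ
    drop-c (Δ , δ , e) with extract Δ δ
    ... | inj₁ δ′                      = Δ , δ′ , e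
    ... | inj₂ (equi , Θ , θ , Δ⊆)     = equi θ (⊩-weaken {c = ⊥ᶜ} Δ⊆ e)

  stage-⊆ : ∀ ds {cs d} → Stage cs d → Stage (ds ++ cs) d
  stage-⊆ []       p = p
  stage-⊆ (_ ∷ ds) p = inj₁ (stage-⊆ ds p)

  stage-consistent : ∀ ds {cs} → Stage (ds ++ cs) ⊫ ⊥ᶜ → Stage cs ⊫ ⊥ᶜ
  stage-consistent []       d = d
  stage-consistent (c ∷ ds) d = stage-consistent ds (stage-conservative c (ds ++ _) d)

  prefix : ℕ → List Code
  prefix zero    = []
  prefix (suc h) = codes h ++ prefix h

  U : Pred Code ℓ
  U c = ∃ λ h → Stage (prefix h) c

  prefix-mono : ∀ {h h′ c} → h ≤ℕ h′ → Stage (prefix h) c → Stage (prefix h′) c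
  prefix-mono {h} h≤h′ p = go (ℕ.≤⇒≤′ h≤h′)
    where
    go : ∀ {h′} → h ≤ℕ′ h′ → Stage (prefix h′) _
    go ≤′-refl                = p
    go (≤′-step {n = h″} q)   = stage-⊆ (codes h″) (go q)

  U-stage : ∀ {Γ} → All U Γ → ∃ λ h → All (Stage (prefix h)) Γ
  U-stage []            = 0 , []
  U-stage ((h , p) ∷ γ) = let h′ , γ′ = U-stage γ in
    h ⊔ℕ h′ , prefix-mono (ℕ.m≤m⊔n h h′) p ∷ All.map (prefix-mono (ℕ.m≤n⊔m h h′)) γ′

  U⊥⇒base : U ⊫ ⊥ᶜ → Stage [] ⊫ ⊥ᶜ
  U⊥⇒base (Γ , γ , d) = let h , γ′ = U-stage γ in descend h (Γ , γ′ , d)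
    where
    descend : ∀ h → Stage (prefix h) ⊫ ⊥ᶜ → Stage [] ⊫ ⊥ᶜ
    descend zero    e = e
    descend (suc h) e = descend h (stage-consistent (codes h) e)

  U⊥⇒⊢goal : U ⊫ ⊥ᶜ → T ⊢ goal
  U⊥⇒⊢goal v = let Δ , δ , e = U⊥⇒base v in
    raa (weaken (λ p → here (trans (¬goal δ p) (cong ¬̇_ goal-σ))) (e {0} λ _ → 0̇))
    where
    ¬goal : ∀ {Δ} → All (Stage []) Δ → ∀ {n} {σ : ℕ → Term Lᵉ n} {φ} →
            φ ∈ map (_⟪ σ ⟫) Δ → φ ≡ ((¬̇ goal) ⟨ [] ⟩) ⟪ σ ⟫
    ¬goal (lift refl ∷ δ) (here e)  = e
    ¬goal (lift refl ∷ δ) (there p) = ¬goal δ p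
    goal-σ : sub ([] ⟪ (λ _ → 0̇) ⟫ˢ) goal ≡ goal
    goal-σ = trans (sub-cong (λ ()) goal) (sub-id goal)

  base⊆stage : ∀ cs {d} → Stage [] d → Stage cs d
  base⊆stage []       p = p
  base⊆stage (_ ∷ cs) p = inj₁ (base⊆stage cs p)

  -- At the moment when `c` is processed, the stage so far is part of `U`, so the hypothesis applies
  -- to it. The resulting inconsistency of `U` descends to the initial stage, which is contained in
  -- the current one.
  maximal : ∀ c → (∀ {Γ} → All U Γ → c ∷ Γ ⊩ ⊥ᶜ → U ⊫ ⊥ᶜ) → U c
  maximal c h with ∈-∃++ (codes-complete c)
  ... | ds , es , eq = suc (heightᶜ c) , subst (λ cs → Stage cs c) (sym split)
    (stage-⊆ ds (inj₂ (inj₁ (refl , equi))))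
    where
    cs = es ++ prefix (heightᶜ c)
    split : prefix (suc (heightᶜ c)) ≡ ds ++ c ∷ cs
    split = trans (cong (_++ _) eq) (++-assoc ds (c ∷ es) _)
    U-cs : ∀ {d} → Stage cs d → U d
    U-cs p = suc (heightᶜ c) , subst (λ cs → Stage cs _) (sym split) (stage-⊆ ds (inj₁ p))
    equi : Equiconsistent (Stage cs) c
    equi γ d = ⊫-mono {c = ⊥ᶜ} (base⊆stage cs) (U⊥⇒base (h (All.map U-cs γ) d))

  U-witness : ∀ c → ∃ λ j → U (witness j c)
  U-witness c with ∈-∃++ (codes-complete c)
  ... | ds , es , eq = _ , suc (heightᶜ c) , subst (λ cs → Stage cs _) (sym split)
    (stage-⊆ ds (inj₂ (inj₂ (lift refl))))
    where
    split : prefix (suc (heightᶜ c)) ≡ ds ++ c ∷ es ++ prefix (heightᶜ c)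
    split = trans (cong (_++ _) eq) (++-assoc ds (c ∷ es) _)

  -- A record, so that c can be read off V c.
  record V (c : Code) : Set ℓ where
    constructor deduce
    field deduced : U ⊫ c

  U⇒V : ∀ {c} → U c → V c
  U⇒V {c} u = deduce (c ∷ [] , u ∷ [] , λ σ → hyp (here refl))

  V-map : ∀ {c d} → (∀ {n Γ} (σ : ℕ → Term Lᵉ n) → T ∣ Γ ⊢ c ⟪ σ ⟫ → T ∣ Γ ⊢ d ⟪ σ ⟫) → V c → V d
  V-map f (deduce (Γ , γ , d)) = deduce (Γ , γ , λ σ → f σ (d σ))

  V-map₂ : ∀ {c d e} → (∀ {n Γ} (σ : ℕ → Term Lᵉ n) → T ∣ Γ ⊢ c ⟪ σ ⟫ → T ∣ Γ ⊢ d ⟪ σ ⟫ → T ∣ Γ ⊢ e ⟪ σ ⟫) →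
           V c → V d → V e
  V-map₂ {c} {d} f (deduce (Γ , γ , p)) (deduce (Δ , δ , q)) = deduce (Γ ++ Δ , All.++⁺ γ δ ,
    λ σ → f σ (⊩-weaken {c = c} (xs⊆xs++ys Γ Δ) p σ) (⊩-weaken {c = d} (xs⊆ys++xs Δ Γ) q σ))

  V-≡ : ∀ {c d} → (∀ {n} (σ : ℕ → Term Lᵉ n) → c ⟪ σ ⟫ ≡ d ⟪ σ ⟫) → V c → V d
  V-≡ c≡d = V-map λ σ → subst (T ∣ _ ⊢_) (c≡d σ)

  V-⇒⁻ : ∀ {φ ψ : Formula Lᵉ n} {ρ} → V ((φ ⇒ ψ) ⟨ ρ ⟩) → V (φ ⟨ ρ ⟩) → V (ψ ⟨ ρ ⟩)
  V-⇒⁻ = V-map₂ λ _ → ⇒-elim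

  V-⊥ : V ⊥ᶜ → ∀ {n} {ρ : Vec Tm n} → V (⊥̇ ⟨ ρ ⟩)
  V-⊥ v = V-≡ (λ _ → refl) v

  -- By maximality it suffices that any refutation of φ ⇒ ψ makes `U` inconsistent. Such a
  -- refutation proves φ by classical logic, so `f` supplies ψ, which yields the refuted
  -- implication.
  V-⇒⁺ : ∀ {φ ψ : Formula Lᵉ n} {ρ} → (V (φ ⟨ ρ ⟩) → V (ψ ⟨ ρ ⟩)) → V ((φ ⇒ ψ) ⟨ ρ ⟩)
  V-⇒⁺ {φ = φ} {ψ} {ρ} f = U⇒V (maximal _ λ {Γ} γ d → V.deduced
    (V-map₂ {(¬̇ (φ ⇒ ψ)) ⟨ ρ ⟩} {ψ ⟨ ρ ⟩} {⊥ᶜ} (λ _ a b → ⇒-elim a (⇒-intro (weaken there b)))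
      (deduce (Γ , γ , λ σ → ⇒-intro (d σ))) (f (deduce (Γ , γ , antecedent d)))))
    where
    antecedent : ∀ {Γ} → (φ ⇒ ψ) ⟨ ρ ⟩ ∷ Γ ⊩ ⊥ᶜ → Γ ⊩ φ ⟨ ρ ⟩
    antecedent d σ = raa (⇒-elim (weaken there (⇒-intro (d σ)))
      (⇒-intro (ex-falso (⇒-elim (hyp (there (here refl))) (hyp (here refl))))))

  V-stable : ∀ {φ : Formula Lᵉ n} {ρ} → ((V (φ ⟨ ρ ⟩) → V ⊥ᶜ) → V ⊥ᶜ) → V (φ ⟨ ρ ⟩)
  V-stable {φ = φ} {ρ} h = V-map (λ σ ¬¬φ → raa (⇒-elim (weaken there ¬¬φ) (hyp (here refl))))
    (V-⇒⁺ {φ = ¬̇ φ} {⊥̇} {ρ} λ ¬φ → V-⊥ (h λ v → V-≡ (λ _ → refl) (V-⇒⁻ ¬φ v)))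

  V-∀⁻ : ∀ {φ : Formula Lᵉ (suc n)} {ρ} → V ((∀̇ φ) ⟨ ρ ⟩) → ∀ t → V (φ ⟨ t ∷ ρ ⟩)
  V-∀⁻ {φ = φ} {ρ} v t = V-map (λ σ d → subst (T ∣ _ ⊢_) (⟪⟫-∀ φ t ρ σ) (∀-elim d (t ⟪ σ ⟫ᵗ))) v

  V-∀⁺ : ∀ {φ : Formula Lᵉ (suc n)} {ρ} → (∀ t → V (φ ⟨ t ∷ ρ ⟩)) → V ((∀̇ φ) ⟨ ρ ⟩)
  -- `par 0` is a dummy: `witness` replaces the first entry.
  V-∀⁺ {φ = φ} {ρ} f = let j , u = U-witness (φ ⟨ par 0 ∷ ρ ⟩) in
    V-≡ (λ σ → sub-ren-suc _ (∀̇ φ)) (V-⇒⁻ (U⇒V u) (f (par j)))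

  infix 4 _≈_

  _≈_ : Tm → Tm → Set ℓ
  s ≈ t = V ((v₀ ≐ v₁) ⟨ s ∷ t ∷ [] ⟩)

  V-subst : ∀ (φ : Formula Lᵉ (suc n)) {s t} ρ → s ≈ t → V (φ ⟨ s ∷ ρ ⟩) → V (φ ⟨ t ∷ ρ ⟩)
  V-subst φ {s} {t} ρ = V-map₂ λ σ e d → subst (T ∣ _ ⊢_) (⟪⟫-∀ φ t ρ σ)
    (≐-subst _ e (subst (T ∣ _ ⊢_) (sym (⟪⟫-∀ φ s ρ σ)) d))

  ≈-refl : ∀ {t} → t ≈ t
  ≈-refl = deduce ([] , [] , λ σ → ≐-refl)

  ≈-sym : ∀ {s t} → s ≈ t → t ≈ s
  ≈-sym {s} s≈t = V-≡ (λ _ → refl) (V-subst (v₀ ≐ v₁) (s ∷ []) s≈t ≈-refl)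

  ≈-trans : ∀ {s t u} → s ≈ t → t ≈ u → s ≈ u
  ≈-trans {s} s≈t t≈u = V-≡ (λ _ → refl) (V-subst (v₁ ≐ v₀) (s ∷ []) t≈u (V-≡ (λ _ → refl) s≈t))

  termModel : Structure ℓ
  termModel = record
    { D = Tm ; 0# = zeroᵖ ; 1# = oneᵖ ; _+_ = _+ᵖ_ ; _*_ = _*ᵖ_ ; exp = expᵖ
    ; ⊥ = V ⊥ᶜ
    ; _≈_ = _≈_
    ; _≤_ = λ s t → V ((v₀ ≤̇ v₁) ⟨ s ∷ t ∷ [] ⟩)
    ; A = λ t → V (𝔸 v₀ ⟨ t ∷ [] ⟩)
    ; ≈-stable = V-stable
    ; ≤-stable = V-stable
    ; A-stable = V-stable
    ; ≈-equiv = record { refl = ≈-refl ; sym = ≈-sym ; trans = ≈-trans }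
    ; +-cong = λ {x} {x′} {y} x≈x′ y≈y′ → V-≡ (λ _ → refl)
        (V-subst (v₁ +̇ v₂ ≐ v₃ +̇ v₀) (x ∷ y ∷ x′ ∷ []) y≈y′ (V-≡ (λ _ → refl)
        (V-subst (v₁ +̇ v₂ ≐ v₀ +̇ v₂) (x ∷ y ∷ []) x≈x′ (V-≡ (λ _ → refl) (≈-refl {x +ᵖ y})))))
    ; *-cong = λ {x} {x′} {y} x≈x′ y≈y′ → V-≡ (λ _ → refl)
        (V-subst (v₁ · v₂ ≐ v₃ · v₀) (x ∷ y ∷ x′ ∷ []) y≈y′ (V-≡ (λ _ → refl)
        (V-subst (v₁ · v₂ ≐ v₀ · v₂) (x ∷ y ∷ []) x≈x′ (V-≡ (λ _ → refl) (≈-refl {x *ᵖ y})))))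
    ; exp-cong = λ {x} {x′} {y} x≈x′ y≈y′ → V-≡ (λ _ → refl)
        (V-subst (𝕖 v₁ v₂ ≐ 𝕖 v₃ v₀) (x ∷ y ∷ x′ ∷ []) y≈y′ (V-≡ (λ _ → refl)
        (V-subst (𝕖 v₁ v₂ ≐ 𝕖 v₀ v₂) (x ∷ y ∷ []) x≈x′ (V-≡ (λ _ → refl) (≈-refl {expᵖ x y})))))
    ; ≤-resp = λ {x} {x′} {y} x≈x′ y≈y′ x≤y → V-≡ (λ _ → refl)
        (V-subst (v₁ ≤̇ v₀) (x′ ∷ []) y≈y′ (V-≡ (λ _ → refl) (V-subst (v₀ ≤̇ v₁) (y ∷ []) x≈x′ x≤y)))
    ; A-resp = V-subst (𝔸 v₀) []
    }

  open Semantics termModel using (⟦_⟧; ⟦_⟧ᵗ; Models)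

  ⟦⟧ᵗ-⟪⟫ : (t : Term Lᵉ m) (ρ : Vec Tm m) (σ : ℕ → Term Lᵉ n) → ⟦ t ⟧ᵗ ρ ⟪ σ ⟫ᵗ ≡ subT (ρ ⟪ σ ⟫ˢ) t
  ⟦⟧ᵗ-⟪⟫ (var i) ρ σ  = refl
  ⟦⟧ᵗ-⟪⟫ 0̇ ρ σ        = refl
  ⟦⟧ᵗ-⟪⟫ 1̇ ρ σ        = refl
  ⟦⟧ᵗ-⟪⟫ (s +̇ t) ρ σ  = cong₂ _+̇_ (⟦⟧ᵗ-⟪⟫ s ρ σ) (⟦⟧ᵗ-⟪⟫ t ρ σ)
  ⟦⟧ᵗ-⟪⟫ (s · t) ρ σ  = cong₂ _·_ (⟦⟧ᵗ-⟪⟫ s ρ σ) (⟦⟧ᵗ-⟪⟫ t ρ σ)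
  ⟦⟧ᵗ-⟪⟫ (𝕖 s t) ρ σ  = cong₂ 𝕖 (⟦⟧ᵗ-⟪⟫ s ρ σ) (⟦⟧ᵗ-⟪⟫ t ρ σ)

  -- The truth lemma. Falsity being interpreted as `V ⊥ᶜ`, the clause for `⊥̇` asks for no
  -- consistency proof.
  truth⇒ : (φ : Formula Lᵉ n) {ρ : Vec Tm n} → ⟦ φ ⟧ ρ → V (φ ⟨ ρ ⟩)
  truth⇐ : (φ : Formula Lᵉ n) {ρ : Vec Tm n} → V (φ ⟨ ρ ⟩) → ⟦ φ ⟧ ρ
  truth⇒ ⊥̇ v           = V-⊥ v
  truth⇒ (s ≐ t) {ρ} v = V-≡ (λ σ → cong₂ _≐_ (⟦⟧ᵗ-⟪⟫ s ρ σ) (⟦⟧ᵗ-⟪⟫ t ρ σ)) v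
  truth⇒ (s ≤̇ t) {ρ} v = V-≡ (λ σ → cong₂ _≤̇_ (⟦⟧ᵗ-⟪⟫ s ρ σ) (⟦⟧ᵗ-⟪⟫ t ρ σ)) v
  truth⇒ (𝔸 t) {ρ} v   = V-≡ (λ σ → cong 𝔸 (⟦⟧ᵗ-⟪⟫ t ρ σ)) v
  truth⇒ (φ ⇒ ψ) f     = V-⇒⁺ λ v → truth⇒ ψ (f (truth⇐ φ v))
  truth⇒ (∀̇ φ) f       = V-∀⁺ λ t → truth⇒ φ (f t)
  truth⇐ ⊥̇ v           = V-≡ (λ _ → refl) v
  truth⇐ (s ≐ t) {ρ} v = V-≡ (λ σ → sym (cong₂ _≐_ (⟦⟧ᵗ-⟪⟫ s ρ σ) (⟦⟧ᵗ-⟪⟫ t ρ σ))) v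
  truth⇐ (s ≤̇ t) {ρ} v = V-≡ (λ σ → sym (cong₂ _≤̇_ (⟦⟧ᵗ-⟪⟫ s ρ σ) (⟦⟧ᵗ-⟪⟫ t ρ σ))) v
  truth⇐ (𝔸 t) {ρ} v   = V-≡ (λ σ → sym (cong 𝔸 (⟦⟧ᵗ-⟪⟫ t ρ σ))) v
  truth⇐ (φ ⇒ ψ) v p   = truth⇐ ψ (V-⇒⁻ v (truth⇒ φ p))
  truth⇐ (∀̇ φ) v t     = truth⇐ φ (V-∀⁻ v t)

  termModel⊨T : Models T
  termModel⊨T {φ} Tφ = truth⇐ φ (deduce ([] , [] , λ σ →
    subst (T ∣ [] ⊢_) (trans (ren≡sub (λ ()) φ) (sub-cong (λ ()) φ)) (axiom Tφ)))

  -- The theory `U` starts from the negation of `goal`, so truth of `goal` makes it inconsistent,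
  -- and that inconsistency descends to the initial stage.
  ⟦goal⟧⇒⊢goal : ⟦ goal ⟧ [] → T ⊢ goal
  ⟦goal⟧⇒⊢goal g = U⊥⇒⊢goal (V.deduced (V-⇒⁻ {φ = goal} {⊥̇} {[]} (U⇒V (0 , lift refl)) (truth⇒ goal g)))

completeness : ∀ {ℓ} (T : Theory Lᵉ ℓ) (φ : Sentence Lᵉ) →
  ((M : Structure ℓ) → Semantics.Models M T → Semantics.⟦_⟧ M φ []) → T ⊢ φ
completeness T φ h = ⟦goal⟧⇒⊢goal (h termModel termModel⊨T)
  where open Henkin T φ

-- Arithmetic in models of IΣ₁

v₅ : ∀ {l n} → Term l (suc (suc (suc (suc (suc (suc n))))))
v₅ = var suc (suc (suc (suc (suc zero))))

module Arithmetic {ℓ} (M : Structure ℓ)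
  (⊨IΣ₁ : ∀ {φ} → IΣ₁ φ → Semantics.⟦_⟧ M φ []) where

  open Structure M
  open Semantics M

  private
    variable
      a b : Level
      X : Set a
      Y : Set b

  -- The double negation monad relative to `⊥`, for classical existence and disjunction. Stable
  -- conclusions such as `≈`, `≤` and `∣` can leave it; a `do` branch ending in `λ _ →` closes by
  -- contradiction.
  C : Set a → Set (a ⊔ ℓ)
  C X = (X → ⊥) → ⊥

  return : X → C X
  return x k = k x

  infixl 1 _>>=_
  _>>=_ : C X → (X → C Y) → C Y
  (m >>= f) k = m λ x → f x k

  -- The interpretations of the abbreviations ∃̇ and ∧̇ are both of the form
  -- ((x : X) → P x → ⊥) → ⊥.
  some : {P : X → Set b} → ((∀ x → P x → ⊥) → ⊥) → C (Σ X P)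
  some h k = h (curry k)

  or : ((X → ⊥) → Y) → C (X ⊎ Y)
  or h k = k (inj₂ (h (k ∘ inj₁)))

  excluded-middle : C (X ⊎ (X → ⊥))
  excluded-middle k = k (inj₂ (k ∘ inj₁))

  -- Ordered semiring

  private
    pa : ∀ {φ} → PA⁻ φ → ⟦ φ ⟧ []
    pa p = ⊨IΣ₁ (pa⁻ p)

  commutativeSemiring : CommutativeSemiring _ _
  commutativeSemiring = record
    { _≈_ = _≈_ ; _+_ = _+_ ; _*_ = _*_ ; 0# = 0# ; 1# = 1#
    ; isCommutativeSemiring = isCommutativeSemiringʳ record
      { +-isCommutativeMonoid = record
        { isMonoid = record
          { isSemigroup = record
            { isMagma = record { isEquivalence = ≈-equiv ; ∙-cong = +-cong }
            ; assoc = pa PA⁻.+-assoc }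
          ; identity = (λ x → ≈-trans (pa PA⁻.+-comm 0# x) (pa PA⁻.+-zero x)) , pa PA⁻.+-zero }
        ; comm = pa PA⁻.+-comm }
      ; *-isCommutativeMonoid = record
        { isMonoid = record
          { isSemigroup = record
            { isMagma = record { isEquivalence = ≈-equiv ; ∙-cong = *-cong }
            ; assoc = pa PA⁻.·-assoc }
          ; identity = (λ x → ≈-trans (pa PA⁻.·-comm 1# x) (pa PA⁻.·-one x)) , pa PA⁻.·-one }
        ; comm = pa PA⁻.·-comm }
      ; distribˡ = pa PA⁻.distrib
      ; zeroʳ = pa PA⁻.·-zero
      }
    }

  open CommutativeSemiring commutativeSemiring public
    using (+-comm; *-comm; *-assoc; +-assoc; +-identityˡ; +-identityʳ; *-identityˡ; *-identityʳ; zeroˡ; zeroʳ; setoid;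
           +-congˡ; +-congʳ; *-congˡ; *-congʳ)
  open import Algebra.Solver.Ring.NaturalCoefficients.Default commutativeSemiring public
    using (solve; _:=_; _:+_; _:*_; con)
  open import Algebra.Properties.CommutativeSemiring.Exp commutativeSemiring public
  open import Relation.Binary.Reasoning.Setoid setoid

  infix 4 _≉_ _<_ _∣_

  _≉_ _<_ _∣_ : D → D → Set ℓ
  x ≉ y = x ≈ y → ⊥
  x < y = x ≤ y × x ≉ y
  x ∣ y = (∀ z → x * z ≈ y → ⊥) → ⊥

  Coprimeᴹ : D → D → Set ℓ
  Coprimeᴹ x y = ∀ d → d ∣ x → d ∣ y → d ≈ 1#

  ⟦<⟧⇐ : ∀ {x y} → x < y → (x ≤ y → C (x ≈ y)) → ⊥
  ⟦<⟧⇐ (x≤y , x≉y) h = h x≤y x≉y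

  ⟦<⟧⇒ : ∀ {x y} → ((x ≤ y → C (x ≈ y)) → ⊥) → x < y
  ⟦<⟧⇒ h = ≤-stable (λ k → h λ p _ → k p) , λ e → h λ _ k → k e

  <-C : ∀ {x y} → C (x < y) → x < y
  <-C h = ≤-stable (λ k → h (k ∘ proj₁)) , λ e → h λ p → proj₂ p e

  ≈⊥ : ∀ {x y} → ⊥ → x ≈ y
  ≈⊥ b = ≈-stable λ _ → b

  ≤-reflexive : ∀ {x y} → x ≈ y → x ≤ y
  ≤-reflexive e = ≤-resp ≈-refl e (pa PA⁻.≤-refl _)

  ≤-refl : ∀ {x} → x ≤ x
  ≤-refl = ≤-reflexive ≈-refl

  ≤-trans : ∀ {x y z} → x ≤ y → y ≤ z → x ≤ z
  ≤-trans = pa PA⁻.≤-trans _ _ _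

  ≤-antisym : ∀ {x y} → x ≤ y → y ≤ x → x ≈ y
  ≤-antisym = pa PA⁻.≤-antisym _ _

  0≤ : ∀ {x} → 0# ≤ x
  0≤ = pa PA⁻.0≤ _

  ≤-or-> : ∀ x y → C (x ≤ y ⊎ y < x)
  ≤-or-> x y = do
    inj₂ y≤x ← or (pa PA⁻.≤-total x y)
      where inj₁ x≤y → return (inj₁ x≤y)
    inj₂ y≉x ← excluded-middle
      where inj₁ y≈x → return (inj₁ (≤-reflexive (≈-sym y≈x)))
    return (inj₂ (y≤x , y≉x))

  <-irrefl : ∀ {x y} → x < y → y ≤ x → ⊥
  <-irrefl (x≤y , x≉y) y≤x = x≉y (≤-antisym x≤y y≤x)

  +-mono-<ʳ : ∀ {x y} z → x < y → x + z < y + z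
  +-mono-<ʳ z p = ⟦<⟧⇒ (pa PA⁻.+-mono-< _ _ z (⟦<⟧⇐ p))

  nonzero⇒0< : ∀ {x} → x ≉ 0# → 0# < x
  nonzero⇒0< x≉0 = 0≤ , x≉0 ∘ ≈-sym

  nonzero⇒1≤ : ∀ {x} → x ≉ 0# → 1# ≤ x
  nonzero⇒1≤ x≉0 = pa PA⁻.discrete _ (⟦<⟧⇐ (nonzero⇒0< x≉0))

  *-mono-<ʳ : ∀ {x y z} → z ≉ 0# → x < y → x * z < y * z
  *-mono-<ʳ z≉0 p = ⟦<⟧⇒ (pa PA⁻.·-mono-< _ _ _ (⟦<⟧⇐ (nonzero⇒0< z≉0)) (⟦<⟧⇐ p))

  ≤-diff : ∀ {x y} → x ≤ y → C (∃ λ z → x + z ≈ y)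
  ≤-diff = some ∘ pa PA⁻.≤-diff _ _

  x≤x+z : ∀ x z → x ≤ x + z
  x≤x+z x z = ≤-stable do
    inj₂ z≉0 ← excluded-middle
      where inj₁ z≈0 → return (≤-reflexive (≈-trans (≈-sym (+-identityʳ x)) (+-congˡ (≈-sym z≈0))))
    return (≤-resp (+-identityˡ x) (+-comm z x) (proj₁ (+-mono-<ʳ x (nonzero⇒0< z≉0))))

  ≤-intro : ∀ {x y} z → x + z ≈ y → x ≤ y
  ≤-intro z e = ≤-resp ≈-refl e (x≤x+z _ z)

  +-mono-≤ : ∀ {x x′ y y′} → x ≤ x′ → y ≤ y′ → x + y ≤ x′ + y′
  +-mono-≤ {x} {x′} {y} {y′} p q = ≤-stable do
    u , x+u ← ≤-diff p
    v , y+v ← ≤-diff q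
    return (≤-intro (u + v) (≈-trans
      (solve 4 (λ x y u v → (x :+ y) :+ (u :+ v) := (x :+ u) :+ (y :+ v)) ≈-refl x y u v) (+-cong x+u y+v)))

  *-mono-≤ : ∀ {x x′ y y′} → x ≤ x′ → y ≤ y′ → x * y ≤ x′ * y′
  *-mono-≤ {x} {x′} {y} {y′} p q = ≤-stable do
    u , x+u ← ≤-diff p
    v , y+v ← ≤-diff q
    return (≤-intro (x * v + u * (y + v)) (≈-trans
      (solve 4 (λ x y u v → x :* y :+ (x :* v :+ u :* (y :+ v)) := (x :+ u) :* (y :+ v)) ≈-refl x y u v)
      (*-cong x+u y+v)))

  +-cancelʳ : ∀ {x y} z → x + z ≈ y + z → x ≈ y
  +-cancelʳ {x} {y} z e = ≈-stable do
    inj₁ x≤y ← ≤-or-> x y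
      where inj₂ y<x → λ _ → proj₂ (+-mono-<ʳ z y<x) (≈-sym e)
    inj₁ y≤x ← ≤-or-> y x
      where inj₂ x<y → λ _ → proj₂ (+-mono-<ʳ z x<y) e
    return (≤-antisym x≤y y≤x)

  +-cancelˡ : ∀ {x y} z → z + x ≈ z + y → x ≈ y
  +-cancelˡ z e = +-cancelʳ z (≈-trans (+-comm _ z) (≈-trans e (+-comm z _)))

  *-cancelʳ : ∀ {x y z} → z ≉ 0# → x * z ≈ y * z → x ≈ y
  *-cancelʳ {x} {y} z≉0 e = ≈-stable do
    inj₁ x≤y ← ≤-or-> x y
      where inj₂ y<x → λ _ → proj₂ (*-mono-<ʳ z≉0 y<x) (≈-sym e)
    inj₁ y≤x ← ≤-or-> y x
      where inj₂ x<y → λ _ → proj₂ (*-mono-<ʳ z≉0 x<y) e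
    return (≤-antisym x≤y y≤x)

  *-cancelˡ : ∀ {x y z} → z ≉ 0# → z * x ≈ z * y → x ≈ y
  *-cancelˡ z≉0 e = *-cancelʳ z≉0 (≈-trans (*-comm _ _) (≈-trans e (*-comm _ _)))

  *-nonzero : ∀ {x y} → x ≉ 0# → y ≉ 0# → x * y ≉ 0#
  *-nonzero x≉0 y≉0 e = x≉0 (*-cancelʳ y≉0 (≈-trans e (≈-sym (zeroˡ _))))

  *-nonzeroˡ : ∀ {x y} → x * y ≉ 0# → x ≉ 0#
  *-nonzeroˡ xy≉0 x≈0 = xy≉0 (≈-trans (*-congʳ x≈0) (zeroˡ _))

  *-nonzeroʳ : ∀ {x y} → x * y ≉ 0# → y ≉ 0#
  *-nonzeroʳ xy≉0 y≈0 = xy≉0 (≈-trans (*-congˡ y≈0) (zeroʳ _))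

  ≉-resp : ∀ {x x′ y} → x ≈ x′ → x ≉ y → x′ ≉ y
  ≉-resp e x≉y p = x≉y (≈-trans e p)

  1≉0 : 1# ≉ 0#
  1≉0 e = proj₂ (⟦<⟧⇒ (pa PA⁻.0<1)) (≈-sym e)

  1≤⇒nonzero : ∀ {x} → 1# ≤ x → x ≉ 0#
  1≤⇒nonzero 1≤x x≈0 = 1≉0 (≤-antisym (≤-resp ≈-refl x≈0 1≤x) 0≤)

  1+-nonzero : ∀ {x} → 1# + x ≉ 0#
  1+-nonzero = 1≤⇒nonzero (x≤x+z _ _)

  nonzero⇒1+ : ∀ {x} → x ≉ 0# → C (∃ λ y → 1# + y ≈ x)
  nonzero⇒1+ x≉0 = ≤-diff (nonzero⇒1≤ x≉0)

  <⇒1+≤ : ∀ {x y} → x < y → 1# + x ≤ y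
  <⇒1+≤ {x} {y} (x≤y , x≉y) = ≤-stable do
    z , e ← ≤-diff x≤y
    return (≤-resp (+-comm x 1#) e (+-mono-≤ ≤-refl (nonzero⇒1≤ λ z≈0 →
      x≉y (≈-trans (≈-sym (+-identityʳ x)) (≈-trans (+-congˡ (≈-sym z≈0)) e)))))

  1+≤⇒< : ∀ {x y} → 1# + x ≤ y → x < y
  1+≤⇒< {x} {y} p = ≤-trans (≤-intro 1# (+-comm x 1#)) p , distinct (≤-diff p)
    where
    distinct : C (∃ λ z → 1# + x + z ≈ y) → x ≉ y
    distinct h x≈y = h λ (z , e) → 1+-nonzero (+-cancelˡ x (begin
      x + (1# + z)  ≈⟨ solve 2 (λ x z → x :+ (con 1 :+ z) := con 1 :+ x :+ z) ≈-refl x z ⟩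
      1# + x + z    ≈⟨ e ⟩
      y             ≈⟨ ≈-sym x≈y ⟩
      x             ≈⟨ ≈-sym (+-identityʳ x) ⟩
      x + 0#        ∎))

  <-≤-trans : ∀ {x y z} → x < y → y ≤ z → x < z
  <-≤-trans p q = 1+≤⇒< (≤-trans (<⇒1+≤ p) q)

  ≤-<-trans : ∀ {x y z} → x ≤ y → y < z → x < z
  ≤-<-trans p q = 1+≤⇒< (≤-trans (+-mono-≤ ≤-refl p) (<⇒1+≤ q))

  <1+⇒≤ : ∀ {x y} → x < 1# + y → x ≤ y
  <1+⇒≤ {x} {y} p = ≤-stable do
    inj₂ y<x ← ≤-or-> x y
      where inj₁ x≤y → return x≤y
    λ _ → <-irrefl p (<⇒1+≤ y<x)

  x≤x*y : ∀ x {y} → y ≉ 0# → x ≤ x * y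
  x≤x*y x y≉0 = ≤-resp (*-identityʳ x) ≈-refl (*-mono-≤ ≤-refl (nonzero⇒1≤ y≉0))

  -- Divisibility

  ∣-intro : ∀ {x y} z → x * z ≈ y → x ∣ y
  ∣-intro z e k = k z e

  ∣-C : ∀ {x y} → C (x ∣ y) → x ∣ y
  ∣-C h k = h λ p → p k

  ∣-refl : ∀ {x} → x ∣ x
  ∣-refl = ∣-intro 1# (*-identityʳ _)

  ∣-trans : ∀ {x y z} → x ∣ y → y ∣ z → x ∣ z
  ∣-trans {x} p q = ∣-C do
    u , xu ← some p
    v , yv ← some q
    return (∣-intro (u * v) (≈-trans (≈-sym (*-assoc x u v)) (≈-trans (*-congʳ xu) yv)))

  ∣-respʳ : ∀ {x y y′} → y ≈ y′ → x ∣ y → x ∣ y′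
  ∣-respʳ e p = ∣-trans p (∣-intro 1# (≈-trans (*-identityʳ _) e))

  ∣-respˡ : ∀ {x x′ y} → x ≈ x′ → x ∣ y → x′ ∣ y
  ∣-respˡ e p = ∣-trans (∣-intro 1# (≈-trans (*-identityʳ _) (≈-sym e))) p

  ∣-*ʳ : ∀ {x y} z → x ∣ y → x ∣ y * z
  ∣-*ʳ z p = ∣-trans p (∣-intro z ≈-refl)

  ∣-*ˡ : ∀ {x y} z → x ∣ y → x ∣ z * y
  ∣-*ˡ z p = ∣-respʳ (*-comm _ z) (∣-*ʳ z p)

  ∣-*-cong : ∀ {x y} z → x ∣ y → z * x ∣ z * y
  ∣-*-cong {x} z p = ∣-C do
    u , xu ← some p
    return (∣-intro u (≈-trans (*-assoc z x u) (*-congˡ xu)))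

  ∣-+ : ∀ {x y z} → x ∣ y → x ∣ z → x ∣ y + z
  ∣-+ {x} p q = ∣-C do
    u , xu ← some p
    v , xv ← some q
    return (∣-intro (u + v) (≈-trans (pa PA⁻.distrib x u v) (+-cong xu xv)))

  ∣-0 : ∀ {x} → x ∣ 0#
  ∣-0 = ∣-intro 0# (zeroʳ _)

  ∣⇒≤ : ∀ {x y} → x ∣ y → y ≉ 0# → x ≤ y
  ∣⇒≤ {x} p y≉0 = ≤-stable do
    u , xu ← some p
    return (≤-resp ≈-refl xu (x≤x*y x (*-nonzeroʳ (≉-resp (≈-sym xu) y≉0))))

  ∣⇒nonzero : ∀ {x y} → x ∣ y → y ≉ 0# → x ≉ 0#
  ∣⇒nonzero p y≉0 x≈0 = p λ z e → *-nonzeroˡ (≉-resp (≈-sym e) y≉0) x≈0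

  ∣-+-cancelˡ : ∀ {x y z} → x ∣ y → x ∣ y + z → x ∣ z
  ∣-+-cancelˡ {x} {y} {z} p q = ∣-C do
    u , xu ← some p
    v , xv ← some q
    inj₁ u≤v ← ≤-or-> u v
      where
      -- Here y + z = x v ≤ x u = y, so z = 0.
      inj₂ v<u → return (∣-respʳ (≈-sym (+-cancelˡ y (≤-antisym
        (≤-resp xv (≈-trans xu (≈-sym (+-identityʳ y))) (*-mono-≤ ≤-refl (proj₁ v<u)))
        (+-mono-≤ ≤-refl 0≤)))) ∣-0)
    w , uw ← ≤-diff u≤v
    return (∣-intro w (+-cancelˡ y (begin
      y + x * w      ≈⟨ +-congʳ (≈-sym xu) ⟩
      x * u + x * w  ≈⟨ ≈-sym (pa PA⁻.distrib x u w) ⟩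
      x * (u + w)    ≈⟨ *-congˡ uw ⟩
      x * v          ≈⟨ xv ⟩
      y + z          ∎)))

  ∣-+-cancelʳ : ∀ {x y z} → x ∣ z → x ∣ y + z → x ∣ y
  ∣-+-cancelʳ p q = ∣-+-cancelˡ p (∣-respʳ (+-comm _ _) q)

  ∣1⇒≈1 : ∀ {x} → x ∣ 1# → x ≈ 1#
  ∣1⇒≈1 p = ≤-antisym (∣⇒≤ p 1≉0) (nonzero⇒1≤ (∣⇒nonzero p 1≉0))

  -- Induction

  infix  5 ¬ᵈ_
  infixr 4 _∧ᵈ_

  ¬ᵈ_ : ∀ {n} {φ : Formula L n} → Δ₀ φ → Δ₀ (¬̇ φ)
  ¬ᵈ d = d ⇒ ⊥̇

  _∧ᵈ_ : ∀ {n} {φ ψ : Formula L n} → Δ₀ φ → Δ₀ ψ → Δ₀ (φ ∧̇ ψ)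
  d ∧ᵈ e = ¬ᵈ (d ⇒ ¬ᵈ e)

  Σ₁-induction : ∀ {n} {φ : Formula L (suc n)} → Σ₁ φ → (ρ : Vec D n) →
                 ⟦ φ ⟧ (0# ∷ ρ) → (∀ x → ⟦ φ ⟧ (x ∷ ρ) → ⟦ φ ⟧ (x + 1# ∷ ρ)) → ∀ x → ⟦ φ ⟧ (x ∷ ρ)
  Σ₁-induction {φ = φ} σ ρ base step = ⟦closure⟧ _ (⊨IΣ₁ (induction φ σ)) ρ
    (⟦sub⟧⇐ (inst-≋ 0̇ ρ) φ base)
    (λ x p → ⟦sub⟧⇐ (λ { zero → ≈-refl ; (suc i) → ≈-refl }) φ (step x p))

  -- The bound m of the quantifier ∀≤ is an additional variable of φ.
  Δ₀-strong-induction : ∀ {n} {φ : Formula L (suc (suc n))} → Δ₀ φ → (ρ : Vec D n) (P : D → Set ℓ) →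
    (∀ {m x} → ⟦ φ ⟧ (x ∷ m ∷ ρ) → P x) → (∀ {m x} → P x → ⟦ φ ⟧ (x ∷ m ∷ ρ)) →
    (∀ x → (∀ y → y < x → P y) → P x) → ∀ x → P x
  Δ₀-strong-induction {φ = φ} d ρ P φ⇒P P⇒φ step x =
    φ⇒P (Σ₁-induction (Δ₀⊆Σ₁ (all≤ v₀ d)) ρ
      (λ y y≤0 → P⇒φ (step y λ z z<y → φ⇒P (stable φ {z ∷ 0# ∷ ρ} λ _ → <-irrefl (<-≤-trans z<y y≤0) 0≤)))
      (λ m IH y y≤m+1 → P⇒φ (step y λ z z<y →
        φ⇒P (IH z (<1+⇒≤ (<-≤-trans z<y (≤-resp ≈-refl (+-comm m 1#) y≤m+1))))))
      x x ≤-refl)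

  divMod : ∀ {u} → u ≉ 0# → ∀ a → C (∃ λ q → ∃ λ r → u * q + r ≈ a × r < u)
  divMod {u} u≉0 a = ⟦φ⟧⇒ (Σ₁-induction {φ = φ} (ex (ex (Δ₀⊆Σ₁ ((_ ≐ _) ∧ᵈ ((_ ≤̇ _) ∧ᵈ ¬ᵈ (_ ≐ _)))))) (u ∷ [])
    (⟦φ⟧⇐ (return (0# , 0# , ≈-trans (+-identityʳ _) (zeroʳ u) , nonzero⇒0< u≉0)))
    (λ a IH → ⟦φ⟧⇐ (step a (⟦φ⟧⇒ IH))) a)
    where
    φ : Formula L 2
    φ = ∃̇ ∃̇ (v₃ · v₁ +̇ v₀ ≐ v₂ ∧̇ v₀ <̇ v₃)
    P : D → Set ℓ
    P a = ∃ λ q → ∃ λ r → u * q + r ≈ a × r < u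
    ⟦φ⟧⇒ : ∀ {a} → ⟦ φ ⟧ (a ∷ u ∷ []) → C (P a)
    ⟦φ⟧⇒ h = do
      q , h₁ ← some h
      r , h₂ ← some h₁
      e , p ← some h₂
      return (q , r , e , ⟦<⟧⇒ p)
    ⟦φ⟧⇐ : ∀ {a} → C (P a) → ⟦ φ ⟧ (a ∷ u ∷ [])
    ⟦φ⟧⇐ h k = h λ (q , r , e , p) → k q λ k′ → k′ r λ k″ → k″ e (⟦<⟧⇐ p)
    step : ∀ a → C (P a) → C (P (a + 1#))
    step a IH = do
      q , r , e , r<u ← IH
      inj₂ r+1≉u ← excluded-middle {X = 1# + r ≈ u}
        where
        inj₁ r+1≈u → return (q + 1# , 0# , (begin
          u * (q + 1#) + 0#  ≈⟨ solve 2 (λ u q → u :* (q :+ con 1) :+ con 0 := u :* q :+ u) ≈-refl u q ⟩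
          u * q + u          ≈⟨ +-congˡ (≈-sym r+1≈u) ⟩
          u * q + (1# + r)   ≈⟨ solve 3 (λ u q r → u :* q :+ (con 1 :+ r) := u :* q :+ r :+ con 1) ≈-refl u q r ⟩
          u * q + r + 1#     ≈⟨ +-congʳ e ⟩
          a + 1#             ∎) , nonzero⇒0< u≉0)
      return (q , 1# + r , (begin
          u * q + (1# + r)   ≈⟨ solve 3 (λ u q r → u :* q :+ (con 1 :+ r) := u :* q :+ r :+ con 1) ≈-refl u q r ⟩
          u * q + r + 1#     ≈⟨ +-congʳ e ⟩
          a + 1#             ∎) , <⇒1+≤ r<u , r+1≉u)

  -- Infinite descent on the cofactor `s`, from g = 1: a common divisor d ≠ 1 of `s` and `t` can be
  -- moved into `g`, which makes `s` smaller. Since x ≠ 0, the bounds g ≤ x and t ≤ y lose nothing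
  -- and make the induction formula Δ₀.
  coprime-reduction : ∀ x y → x ≉ 0# → C (∃ λ g → ∃ λ s → ∃ λ t → x ≈ g * s × y ≈ g * t × Coprimeᴹ s t)
  coprime-reduction x y x≉0 k = Δ₀-strong-induction
    {φ = ∀≤ v₂ (∀≤ v₄ (v₄ ≐ v₁ · v₂ ⇒ v₅ ≐ v₁ · v₀ ⇒ ⊥̇))}
    (all≤ v₂ (all≤ v₄ ((_ ≐ _) ⇒ (_ ≐ _) ⇒ ⊥̇))) (x ∷ y ∷ []) P
    (λ h g t x≈gs y≈gt → h g (∣⇒≤ (∣-intro _ (≈-sym x≈gs)) x≉0) t
      (≤-resp ≈-refl (≈-trans (*-comm t g) (≈-sym y≈gt)) (x≤x*y t (*-nonzeroˡ (≉-resp x≈gs x≉0)))) x≈gs y≈gt)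
    (λ h g _ t _ → h g t)
    step x 1# y (≈-sym (*-identityˡ x)) (≈-sym (*-identityˡ y))
    where
    P : D → Set ℓ
    P s = ∀ g t → x ≈ g * s → y ≈ g * t → ⊥
    step : ∀ s → (∀ s′ → s′ < s → P s′) → P s
    step s IH g t x≈gs y≈gt = k (g , s , t , x≈gs , y≈gt , λ d d∣s d∣t → ≈-stable λ d≉1 →
      d∣s λ s′ ds′≈s → d∣t λ t′ dt′≈t →
      let s≉0  = *-nonzeroʳ (≉-resp x≈gs x≉0)
          s′≉0 = *-nonzeroʳ (≉-resp (≈-sym ds′≈s) s≉0)
          1<d  = nonzero⇒1≤ (∣⇒nonzero d∣s s≉0) , d≉1 ∘ ≈-sym
          s′<s = ≤-<-trans (≤-reflexive (≈-sym (*-identityˡ s′)))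
                   (<-≤-trans (*-mono-<ʳ s′≉0 1<d) (≤-reflexive ds′≈s))
      in IH s′ s′<s (g * d) t′
           (≈-trans x≈gs (≈-trans (*-congˡ (≈-sym ds′≈s)) (≈-sym (*-assoc g d s′))))
           (≈-trans y≈gt (≈-trans (*-congˡ (≈-sym dt′≈t)) (≈-sym (*-assoc g d t′)))))

  -- Primes

  Primeᴹ : D → Set ℓ
  Primeᴹ p = 1# < p × (∀ d → d ∣ p → d ≉ 1# → d ≈ p)

  ⟦Prime⟧⇒ : ∀ {p} → ⟦ Prime {L} v₀ ⟧ (p ∷ []) → Primeᴹ p
  ⟦Prime⟧⇒ h = <-C (do
      1<p , _ ← some h
      return (⟦<⟧⇒ 1<p)) ,
    λ d d∣p d≉1 → ≈-stable do
      _ , irreducible ← some h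
      return (irreducible d d∣p d≉1)

  prime-nonzero : ∀ {p} → Primeᴹ p → p ≉ 0#
  prime-nonzero ((1≤p , _) , _) = 1≤⇒nonzero 1≤p

  prime∤⇒coprime : ∀ {p x} → Primeᴹ p → (p ∣ x → ⊥) → Coprimeᴹ p x
  prime∤⇒coprime (_ , pr) p∤x d d∣p d∣x = ≈-stable λ d≉1 → p∤x (∣-respˡ (pr d d∣p d≉1) d∣x)

  -- The hypothesis is the interpretation of ∃≤ y (x · z ≐ y).
  bounded∣⇒ : ∀ {x y} → ((∀ z → ((z ≤ y → x * z ≉ y) → ⊥) → ⊥) → ⊥) → x ∣ y
  bounded∣⇒ h k = h λ z h′ → h′ λ _ → k z

  bounded∣⇐ : ∀ {x y} → x ≉ 0# → x ∣ y → (∀ z → ((z ≤ y → x * z ≉ y) → ⊥) → ⊥) → ⊥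
  bounded∣⇐ {x} x≉0 p k = p λ z e → k z λ h → h (≤-resp ≈-refl (≈-trans (*-comm z x) e) (x≤x*y z x≉0)) e

  -- Strong induction on the multiplier `u` of `b`. If p ≤ u, subtract `p`. Otherwise divide p = u q
  -- + r: then `p` divides r b with r < u, so r = 0 and `u` divides `p`; being smaller than `p` it
  -- is 1, against `p` not dividing `b`.
  euclid : ∀ {p a b} → Primeᴹ p → p ∣ a * b → (p ∣ b → ⊥) → p ∣ a
  euclid {p} {a} {b} pr@(1<p , irreducible) p∣ab p∤b = Δ₀-strong-induction
    {φ = ∃≤ (v₀ · v₃) (v₃ · v₀ ≐ v₁ · v₄) ⇒ ∃≤ v₀ (v₃ · v₀ ≐ v₁)}
    (ex≤ _ (_ ≐ _) ⇒ ex≤ _ (_ ≐ _)) (p ∷ b ∷ []) (λ u → p ∣ u * b → p ∣ u)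
    (λ h p∣ub → bounded∣⇒ (h (bounded∣⇐ p≉0 p∣ub)))
    (λ h p∣ub → bounded∣⇐ p≉0 (h (bounded∣⇒ p∣ub)))
    step a p∣ab
    where
    p≉0 = prime-nonzero pr
    step : ∀ u → (∀ v → v < u → p ∣ v * b → p ∣ v) → p ∣ u * b → p ∣ u
    step u IH p∣ub = ∣-C do
      inj₂ u<p ← ≤-or-> p u
        where
        inj₁ p≤u → do
          v , p+v≈u ← ≤-diff p≤u
          let v<u = ≤-<-trans (≤-reflexive (≈-sym (+-identityˡ v)))
                      (<-≤-trans (+-mono-<ʳ v (nonzero⇒0< p≉0)) (≤-reflexive p+v≈u))
              p∣vb = ∣-+-cancelˡ (∣-*ʳ b ∣-refl) (∣-respʳ (≈-trans (*-congʳ (≈-sym p+v≈u))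
                       (solve 3 (λ p v b → (p :+ v) :* b := p :* b :+ v :* b) ≈-refl p v b)) p∣ub)
          return (∣-respʳ p+v≈u (∣-+ ∣-refl (IH v v<u p∣vb)))
      inj₂ u≉0 ← excluded-middle
        where inj₁ u≈0 → return (∣-respʳ (≈-sym u≈0) ∣-0)
      q , r , uq+r≈p , r<u ← divMod u≉0 p
      let p∣rb = ∣-+-cancelˡ (∣-*ʳ q p∣ub) (∣-respʳ (≈-trans (*-congʳ (≈-sym uq+r≈p))
                   (solve 4 (λ u q r b → (u :* q :+ r) :* b := u :* b :* q :+ r :* b) ≈-refl u q r b))
                   (∣-*ʳ b ∣-refl))
      inj₁ r≈0 ← excluded-middle
        where inj₂ r≉0 → λ _ → <-irrefl (≤-<-trans (∣⇒≤ (IH r r<u p∣rb) r≉0) (<-≤-trans r<u (proj₁ u<p))) ≤-refl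
      let u∣p = ∣-intro q (≈-trans (≈-sym (+-identityʳ _)) (≈-trans (+-congˡ (≈-sym r≈0)) uq+r≈p))
      λ _ → proj₂ u<p (irreducible u u∣p λ u≈1 → p∤b (∣-respʳ (≈-trans (*-congʳ u≈1) (*-identityˡ b)) p∣ub))

  prime-∣-* : ∀ {p a b} → Primeᴹ p → p ∣ a * b → C (p ∣ a ⊎ p ∣ b)
  prime-∣-* pr p∣ab = do
    inj₂ p∤b ← excluded-middle
      where inj₁ p∣b → return (inj₂ p∣b)
    return (inj₁ (euclid pr p∣ab p∤b))

  -- Gödel's β function

  remainder-unique : ∀ {m q v q′ v′} → v < m → v′ < m → q * m + v ≈ q′ * m + v′ → v ≈ v′
  remainder-unique v<m v′<m e = ≈-stable do
    inj₁ q≤q′ ← ≤-or-> _ _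
      where inj₂ q′<q → return (≈-sym (go v′<m (proj₁ q′<q) (≈-sym e)))
    return (go v<m q≤q′ e)
    where
    go : ∀ {m q v q′ v′} → v < m → q ≤ q′ → q * m + v ≈ q′ * m + v′ → v ≈ v′
    go {m} {q} {v} {q′} {v′} v<m q≤q′ e = ≈-stable do
      z , q+z≈q′ ← ≤-diff q≤q′
      let v≈ = +-cancelˡ (q * m) (begin
            q * m + v             ≈⟨ e ⟩
            q′ * m + v′           ≈⟨ +-congʳ (*-congʳ (≈-sym q+z≈q′)) ⟩
            (q + z) * m + v′      ≈⟨ solve 4 (λ q z m v → (q :+ z) :* m :+ v := q :* m :+ (z :* m :+ v)) ≈-refl q z m v′ ⟩
            q * m + (z * m + v′)  ∎)
      inj₁ z≈0 ← excluded-middle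
        where inj₂ z≉0 → λ _ → <-irrefl v<m (≤-trans (x≤x*y m z≉0) (≤-trans (≤-reflexive (*-comm m z))
                (≤-trans (x≤x+z _ v′) (≤-reflexive (≈-sym v≈)))))
      return (≈-trans v≈ (≈-trans (+-congʳ (≈-trans (*-congʳ z≈0) (zeroˡ m))) (+-identityˡ v′)))

  modulus : D → D → D
  modulus d i = 1# + (i + 1#) * d

  module _ (c d : D) where

    record Entry (i v : D) : Set ℓ where
      constructor entry
      field
        bounded  : v ≤ (i + 1#) * d
        {quotient} : D
        equation : c ≈ quotient * modulus d i + v

    ⟦β⟧ : D → D → Set ℓ
    ⟦β⟧ i v = ⟦ β {L} v₃ v₂ v₁ v₀ ⟧ (v ∷ i ∷ d ∷ c ∷ [])

    β⇒ : ∀ {i v} → ⟦β⟧ i v → C (Entry i v)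
    β⇒ h = do
      v≤ , h₁ ← some h
      q , h₂ ← some h₁
      _ , e ← some h₂
      return (entry v≤ e)

    β⇐ : ∀ {i v} → C (Entry i v) → ⟦β⟧ i v
    β⇐ h k = h λ (entry v≤ {q} e) → k v≤ λ k′ → k′ q λ k″ → k″
      (≤-trans (x≤x*y q 1+-nonzero) (≤-intro _ (≈-sym e))) e

    entry-< : ∀ {i v} → v ≤ (i + 1#) * d → v < modulus d i
    entry-< v≤ = 1+≤⇒< (+-mono-≤ ≤-refl v≤)

    entry-unique : ∀ {i v v′} → Entry i v → Entry i v′ → v ≈ v′
    entry-unique (entry v≤ e) (entry v′≤ e′) =
      remainder-unique (entry-< v≤) (entry-< v′≤) (≈-trans (≈-sym e) e′)

    entry-respˡ : ∀ {i i′ v} → i ≈ i′ → Entry i v → Entry i′ v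
    entry-respˡ i≈i′ (entry v≤ e) = entry (≤-resp ≈-refl (*-congʳ (+-congʳ i≈i′)) v≤)
      (≈-trans e (+-congʳ (*-congˡ (+-congˡ (*-congʳ (+-congʳ i≈i′))))))

    entry-respʳ : ∀ {i v v′} → v ≈ v′ → Entry i v → Entry i v′
    entry-respʳ v≈v′ (entry v≤ e) = entry (≤-resp v≈v′ ≈-refl v≤) (≈-trans e (+-congˡ v≈v′))

  -- The radical

  -- Every divisor e > 1 of s has a divisor in (1 , i], which for the i-th term s of
  -- the recursion defining rad keeps primes above i from dividing s.
  Smooth : D → D → Set ℓ
  Smooth i s = ∀ p → p ∣ s → p ≉ 1# → C (∃ λ e → e ≤ i × e ≉ 1# × e ∣ p)

  module _ {N w r : D} (w≉0 : w ≉ 0#) (N⇒w : ∀ p → Primeᴹ p → p ∣ N → p ∣ w)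
           (rad : ⟦ Rad {L} v₁ v₀ ⟧ (r ∷ N ∷ [])) where

    private
      module _ (c d : D) where

        Invariant : D → Set ℓ
        Invariant i = i ≤ N → C (∃ λ s → Entry c d i s × s ∣ w × Smooth i s)

        -- A Δ₀ form of `Invariant`. The bounds are harmless because `s`, and with it each divisor
        -- `p` of `s`, divides `w` ≠ 0.
        φ : Formula L 5
        φ = v₀ ≤̇ v₄ ⇒ ∃≤ v₃ (β v₂ v₃ v₁ v₀ ∧̇ ∃≤ v₄ (v₁ · v₀ ≐ v₅)
          ∧̇ ∀≤ v₄ (∃≤ v₁ (v₁ · v₀ ≐ v₂) ⇒ ¬̇ v₀ ≐ 1̇ ⇒ ∃≤ v₂ (¬̇ v₀ ≐ 1̇ ∧̇ ∃≤ v₁ (v₁ · v₀ ≐ v₂))))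

        φ-Δ₀ : Δ₀ φ
        φ-Δ₀ = (_ ≤̇ _) ⇒ ex≤ _ (((_ ≤̇ _) ∧ᵈ ex≤ _ (_ ≐ _)) ∧ᵈ ex≤ _ (_ ≐ _)
          ∧ᵈ all≤ _ (ex≤ _ (_ ≐ _) ⇒ ¬ᵈ (_ ≐ _) ⇒ ex≤ _ (¬ᵈ (_ ≐ _) ∧ᵈ ex≤ _ (_ ≐ _))))

        env : Vec D 4
        env = c ∷ d ∷ w ∷ N ∷ []

        ⟦φ⟧⇒ : ∀ {i} → ⟦ φ ⟧ (i ∷ env) → Invariant i
        ⟦φ⟧⇒ h i≤N = do
          s , h₁ ← some (h i≤N)
          _ , h₂ ← some h₁
          βs , h₃ ← some h₂
          s∣w , sm ← some h₃
          en ← β⇒ c d βs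
          return (s , en , bounded∣⇒ s∣w , λ p p∣s p≉1 → do
            let p≉0 = ∣⇒nonzero p∣s (∣⇒nonzero (bounded∣⇒ s∣w) w≉0)
            e , h₄ ← some (sm p (∣⇒≤ (∣-trans p∣s (bounded∣⇒ s∣w)) w≉0) (bounded∣⇐ p≉0 p∣s) p≉1)
            e≤i , h₅ ← some h₄
            e≉1 , e∣p ← some h₅
            return (e , e≤i , e≉1 , bounded∣⇒ e∣p))

        ⟦φ⟧⇐ : ∀ {i} → Invariant i → ⟦ φ ⟧ (i ∷ env)
        ⟦φ⟧⇐ h i≤N k = h i≤N λ (s , en , s∣w , sm) → k s λ k₁ → k₁ (∣⇒≤ s∣w w≉0) λ k₂ →
          k₂ (β⇐ c d (return en)) λ k₃ → k₃ (bounded∣⇐ (∣⇒nonzero s∣w w≉0) s∣w) λ p _ p∣s p≉1 k₄ →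
          sm p (bounded∣⇒ p∣s) p≉1 λ (e , e≤i , e≉1 , e∣p) → k₄ e λ k₅ → k₅ e≤i λ k₆ → k₆ e≉1
          (bounded∣⇐ (∣⇒nonzero e∣p (∣⇒nonzero (bounded∣⇒ p∣s) (∣⇒nonzero s∣w w≉0))) e∣p)

      -- A divisor `p` of s q is either a multiple of `q`, which then serves as `e`, or already
      -- divides `s`: in p u = s q the prime `q` divides `u` and can be cancelled.
      smooth-* : ∀ {i q s} → Smooth i s → Primeᴹ q → q ≤ i + 1# → s ≉ 0# → Smooth (i + 1#) (s * q)
      smooth-* {i} {q} {s} sm pr q≤ s≉0 p p∣sq p≉1 = do
        inj₂ q∤p ← excluded-middle
          where inj₁ q∣p → return (q , q≤ , proj₂ (proj₁ pr) ∘ ≈-sym , q∣p)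
        u , pu≈sq ← some p∣sq
        u′ , u′q≈u ← some (euclid pr (∣-intro s (≈-trans (*-comm q s) (≈-trans (≈-sym pu≈sq) (*-comm p u)))) q∤p)
        let p∣s = ∣-intro u′ (*-cancelʳ (prime-nonzero pr) (begin
              p * u′ * q    ≈⟨ solve 3 (λ p u q → p :* u :* q := p :* (q :* u)) ≈-refl p u′ q ⟩
              p * (q * u′)  ≈⟨ *-congˡ u′q≈u ⟩
              p * u         ≈⟨ pu≈sq ⟩
              s * q         ∎))
        e , e≤i , e≉1 , e∣p ← sm p p∣s p≉1
        return (e , ≤-trans e≤i (x≤x+z i 1#) , e≉1 , e∣p)

    -- Every partial product `s` divides `w`. When the prime q = i + 1 is multiplied in, smoothness
    -- shows that `q` does not divide `s`: the divisor `e` ≤ i of `q` would be `q` itself. Writing w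
    -- = s t, Euclid's lemma puts `q` into `t`, so s q still divides `w`.
    rad≤ : r ≤ w
    rad≤ = ≤-stable do
      c , h₁ ← some rad
      d , h₂ ← some h₁
      β0 , h₃ ← some h₂
      βstep , βN ← some h₃
      let
        base : Invariant c d 0#
        base _ = do
          en ← β⇒ c d β0
          return (1# , en , ∣-intro w (*-identityˡ w) , λ p p∣1 p≉1 _ → p≉1 (∣1⇒≈1 p∣1))
        step : ∀ i → Invariant c d i → Invariant c d (i + 1#)
        step i IH i+1≤N = do
          let q = i + 1#
              i<N = 1+≤⇒< (≤-resp (+-comm i 1#) ≈-refl i+1≤N)
          s , en , s∣w , sm ← IH (proj₁ i<N)
          s₁ , k₁ ← some (βstep i (proj₁ i<N) (⟦<⟧⇐ i<N))
          _ , k₂ ← some k₁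
          s′ , k₃ ← some k₂
          _ , k₄ ← some k₃
          βs₁ , k₅ ← some k₄
          βs′ , k₆ ← some k₅
          isPrime , notPrime ← some k₆
          en₁ ← β⇒ c d βs₁
          en′ ← β⇒ c d βs′
          let s₁≈s = entry-unique c d en₁ en
              s≉0 = ∣⇒nonzero s∣w w≉0
          inj₁ pd ← excluded-middle
            where
            inj₂ ¬pd → do
              let s′≈s = ≈-trans (notPrime ¬pd) s₁≈s
              return (s , entry-respʳ c d s′≈s en′ , s∣w , λ p p∣s p≉1 → do
                e , e≤i , e≉1 , e∣p ← sm p p∣s p≉1
                return (e , ≤-trans e≤i (x≤x+z i 1#) , e≉1 , e∣p))
          let s′≈sq = ≈-trans (isPrime pd) (*-congʳ s₁≈s)
          ⟦q⟧ , q∣N ← some pd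
          let pr = ⟦Prime⟧⇒ ⟦q⟧
              q∤s : q ∣ s → ⊥
              q∤s q∣s = sm q q∣s (proj₂ (proj₁ pr) ∘ ≈-sym) λ (e , e≤i , e≉1 , e∣q) →
                <-irrefl (1+≤⇒< (≤-reflexive (+-comm 1# i))) (≤-resp (proj₂ pr e e∣q e≉1) ≈-refl e≤i)
          t , st≈w ← some s∣w
          let q∣ts = ∣-respʳ (≈-trans (≈-sym st≈w) (*-comm s t)) (N⇒w q pr q∣N)
          return (s * q , entry-respʳ c d s′≈sq en′ ,
            ∣-respʳ st≈w (∣-*-cong s (euclid pr q∣ts q∤s)) , smooth-* sm pr ≤-refl s≉0)
      s , en , s∣w , _ ← ⟦φ⟧⇒ c d (Σ₁-induction {φ = φ c d} (Δ₀⊆Σ₁ (φ-Δ₀ c d)) (env c d)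
        (⟦φ⟧⇐ c d base) (λ i IH → ⟦φ⟧⇐ c d (step i (⟦φ⟧⇒ c d IH))) N) ≤-refl
      en′ ← β⇒ c d βN
      return (≤-resp (entry-unique c d en en′) ≈-refl (∣⇒≤ s∣w w≉0))

  -- Standard elements

  nat : ℕ → D
  nat zero    = 0#
  nat (suc k) = nat k + 1#

  nat-+ : ∀ j k → nat (j +ℕ k) ≈ nat j + nat k
  nat-+ zero    k = ≈-sym (+-identityˡ _)
  nat-+ (suc j) k = ≈-trans (+-congʳ (nat-+ j k))
    (solve 2 (λ x y → (x :+ y) :+ con 1 := x :+ con 1 :+ y) ≈-refl (nat j) (nat k))

  nat-* : ∀ j k → nat (j *ℕ k) ≈ nat j * nat k
  nat-* zero    k = ≈-sym (zeroˡ _)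
  nat-* (suc j) k = begin
    nat (k +ℕ j *ℕ k)      ≈⟨ nat-+ k (j *ℕ k) ⟩
    nat k + nat (j *ℕ k)   ≈⟨ +-congˡ (nat-* j k) ⟩
    nat k + nat j * nat k  ≈⟨ solve 2 (λ x y → y :+ x :* y := (x :+ con 1) :* y) ≈-refl (nat j) (nat k) ⟩
    (nat j + 1#) * nat k   ∎

  nat≉0 : ∀ k .{{_ : NonZero k}} → nat k ≉ 0#
  nat≉0 (suc k) = ≉-resp (+-comm 1# (nat k)) 1+-nonzero

  <nat⇒ : ∀ k {x} → x < nat k → C (∃ λ j → j <ℕ k × x ≈ nat j)
  <nat⇒ zero    x<0 = λ _ → <-irrefl x<0 0≤
  <nat⇒ (suc k) x<k+1 = do
    inj₂ x≉k ← excluded-middle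
      where inj₁ x≈k → return (k , ℕ.≤-refl , x≈k)
    j , j<k , x≈j ← <nat⇒ k (<1+⇒≤ (<-≤-trans x<k+1 (≤-reflexive (+-comm (nat k) 1#))) , x≉k)
    return (j , ℕ.m≤n⇒m≤1+n j<k , x≈j)

  -- Chinese remainder theorem for a standard number of moduli

  -- Coprimality in Bézout form, written without subtraction; it passes to products and supplies the
  -- coefficients for the Chinese remainder theorem.
  Invertible : (m x : D) → Set ℓ
  Invertible m x = C (∃ λ u → ∃ λ w → x * u ≈ 1# + w * m)

  invertible-* : ∀ {m x y} → Invertible m x → Invertible m y → Invertible m (x * y)
  invertible-* {m} {x} {y} p q = do
    u , w , xu ← p
    v , z , yv ← q
    return (u * v , w + z + w * z * m , (begin
      x * y * (u * v)              ≈⟨ solve 4 (λ x y u v → x :* y :* (u :* v) := (x :* u) :* (y :* v)) ≈-refl x y u v ⟩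
      x * u * (y * v)              ≈⟨ *-cong xu yv ⟩
      (1# + w * m) * (1# + z * m)  ≈⟨ solve 3 (λ w z m → (con 1 :+ w :* m) :* (con 1 :+ z :* m)
                                        := con 1 :+ (w :+ z :+ w :* z :* m) :* m) ≈-refl w z m ⟩
      1# + (w + z + w * z * m) * m ∎))

  -- An inverse of x is obtained from x * u ≡ -1 upon multiplication by m - 1 = μ.
  invertible-neg : ∀ {m μ x u w} → 1# + μ ≈ m → μ ≉ 0# → w ≉ 0# → x * u + 1# ≈ w * m → Invertible m x
  invertible-neg {m} {μ} {x} {u} {w} 1+μ≈m μ≉0 w≉0 e = do
    v , 1+v≈wμ ← nonzero⇒1+ (*-nonzero w≉0 μ≉0)
    return (u * μ , v , +-cancelʳ m (begin
      x * (u * μ) + m         ≈⟨ +-congˡ (≈-sym 1+μ≈m) ⟩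
      x * (u * μ) + (1# + μ)  ≈⟨ solve 3 (λ x u μ → x :* (u :* μ) :+ (con 1 :+ μ) := (x :* u :+ con 1) :* μ :+ con 1) ≈-refl x u μ ⟩
      (x * u + 1#) * μ + 1#   ≈⟨ +-congʳ (*-congʳ e) ⟩
      w * m * μ + 1#          ≈⟨ solve 3 (λ w m μ → w :* m :* μ :+ con 1 := w :* μ :* m :+ con 1) ≈-refl w m μ ⟩
      w * μ * m + 1#          ≈⟨ +-congʳ (*-congʳ (≈-sym 1+v≈wμ)) ⟩
      (1# + v) * m + 1#       ≈⟨ solve 2 (λ v m → (con 1 :+ v) :* m :+ con 1 := con 1 :+ v :* m :+ m) ≈-refl v m ⟩
      1# + v * m + m          ∎))

  module _ (m s : ℕ → D) (N : ℕ) (m≉0 : ∀ i → m i ≉ 0#)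
           (coprime : ∀ {i j} → j <ℕ i → i <ℕ N → Invertible (m i) (m j)) where

    private
      product : ℕ → D
      product zero    = 1#
      product (suc n) = product n * m n

      product-invertible : ∀ n {i} → n ≤ℕ i → i <ℕ N → Invertible (m i) (product n)
      product-invertible zero {i} _ _ = return (1# , 0# ,
        solve 1 (λ m → con 1 :* con 1 := con 1 :+ con 0 :* m) ≈-refl (m i))
      product-invertible (suc n) n<i i<N =
        invertible-* (product-invertible n (ℕ.<⇒≤ n<i) i<N) (coprime n<i i<N)

      ∣-product : ∀ {n i} → suc i ≤ℕ′ n → m i ∣ product n
      ∣-product ≤′-refl       = ∣-*ˡ _ ∣-refl
      ∣-product (≤′-step i<n) = ∣-*ʳ _ (∣-product i<n)

    chinese-remainder : ∀ n → n ≤ℕ N → C (∃ λ c → ∀ i → i <ℕ n → C (∃ λ q → c ≈ q * m i + s i))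
    chinese-remainder zero    _   = return (0# , λ _ ())
    chinese-remainder (suc n) n<N = do
      c , c≡s ← chinese-remainder n (ℕ.<⇒≤ n<N)
      u , w , Pu ← product-invertible n ℕ.≤-refl n<N
      μ , 1+μ≈m ← nonzero⇒1+ (m≉0 n)
      let P = product n
          -- As μ ≡ -1 modulo `m n`, this is the missing difference s n - c. Multiplied by P u ≡ 1
          -- it corrects the new remainder; being a multiple of `P`, the correction leaves the old
          -- ones unchanged.
          t = s n + μ * c
          new = begin
            c + t * (P * u)                     ≈⟨ +-congˡ (*-congˡ Pu) ⟩
            c + t * (1# + w * m n)              ≈⟨ solve 5 (λ c s μ w m → c :+ (s :+ μ :* c) :* (con 1 :+ w :* m)
                                                    := (con 1 :+ μ) :* c :+ (s :+ μ :* c) :* w :* m :+ s) ≈-refl c (s n) μ w (m n) ⟩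
            (1# + μ) * c + t * w * m n + s n    ≈⟨ +-congʳ (+-congʳ (*-congʳ 1+μ≈m)) ⟩
            m n * c + t * w * m n + s n         ≈⟨ solve 5 (λ m c t w s → m :* c :+ t :* w :* m :+ s := (c :+ t :* w) :* m :+ s)
                                                    ≈-refl (m n) c t w (s n) ⟩
            (c + t * w) * m n + s n             ∎
      return (c + t * (P * u) , λ i i<n+1 → case-< i<n+1
        (λ { refl → return (_ , new) })
        (λ i<n → do
          q , c≈ ← c≡s i i<n
          z , mz≈P ← some (∣-product (ℕ.≤⇒≤′ i<n))
          return (q + t * z * u , (begin
            c + t * (P * u)                        ≈⟨ +-cong c≈ (*-congˡ (*-congʳ (≈-sym mz≈P))) ⟩
            q * m i + s i + t * (m i * z * u)      ≈⟨ solve 6 (λ q m s t z u → q :* m :+ s :+ t :* (m :* z :* u)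
                                                        := (q :+ t :* z :* u) :* m :+ s) ≈-refl q (m i) (s i) t z u ⟩
            (q + t * z * u) * m i + s i            ∎))))
      where
      case-< : ∀ {a} {A : Set a} {i n} → i <ℕ suc n → (i ≡ n → A) → (i <ℕ n → A) → A
      case-< {i = i} {n} i<n+1 f g with i ℕ.≟ n
      ... | yes i≡n = f i≡n
      ... | no i≢n  = g (ℕ.≤∧≢⇒< (ℕ.≤-pred i<n+1) i≢n)

  -- β-codes of standard sequences

  private
    sum : (ℕ → D) → ℕ → D
    -- Starting at 1 keeps the sum, and so the `d` built from it, nonzero.
    sum s zero    = 1#
    sum s (suc n) = sum s n + s n

    ≤-sum : ∀ {s n i} → suc i ≤ℕ′ n → s i ≤ sum s n
    ≤-sum ≤′-refl       = ≤-intro _ (+-comm _ _)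
    ≤-sum (≤′-step i<n) = ≤-trans (≤-sum i<n) (x≤x+z _ _)

    sum≉0 : ∀ s n → sum s n ≉ 0#
    sum≉0 s zero    = 1≉0
    sum≉0 s (suc n) = 1≤⇒nonzero (≤-trans (nonzero⇒1≤ (sum≉0 s n)) (x≤x+z _ _))

    ∣! : ∀ {k e} → suc e ≤ℕ k → suc e ℕ.∣ k !
    ∣! {k} {e} e<k = ℕ.∣-trans (ℕ.m∣m*n (e !)) (ℕ.m≤n⇒m!∣n! e<k)

  -- i = j + (e + 1), and d is a multiple of e + 1.
  modulus-invertible : ∀ d {e d′} j → nat (suc e) * d′ ≈ d → d ≉ 0# →
    Invertible (modulus d (nat (j +ℕ suc e))) (modulus d (nat j))
  -- Modulo 1 + I d one has I d ≡ -1, so I (1 + J d) ≡ I - J = E; the further factor I d′ turns this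
  -- into I d ≡ -1.
  modulus-invertible d {e} {d′} j E*d′≈d d≉0 = invertible-neg {u = I * I * d′} {w = 1# + I * J * d′} ≈-refl
    (*-nonzero (nat≉0 (suc (j +ℕ suc e))) d≉0) 1+-nonzero (begin
      (1# + J * d) * (I * I * d′) + 1#
        ≈⟨ solve 4 (λ I J d d′ → (con 1 :+ J :* d) :* (I :* I :* d′) :+ con 1 := I :* d′ :* (I :+ I :* J :* d) :+ con 1) ≈-refl I J d d′ ⟩
      I * d′ * (I + I * J * d) + 1#
        ≈⟨ +-congʳ (*-congˡ (+-congʳ I≈)) ⟩
      I * d′ * (J + E + I * J * d) + 1#
        ≈⟨ solve 5 (λ I J E d d′ → I :* d′ :* (J :+ E :+ I :* J :* d) :+ con 1
             := I :* (E :* d′) :+ (I :* d′ :* J :* (con 1 :+ I :* d) :+ con 1)) ≈-refl I J E d d′ ⟩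
      I * (E * d′) + (I * d′ * J * (1# + I * d) + 1#)
        ≈⟨ +-congʳ (*-congˡ E*d′≈d) ⟩
      I * d + (I * d′ * J * (1# + I * d) + 1#)
        ≈⟨ solve 4 (λ I J d d′ → I :* d :+ (I :* d′ :* J :* (con 1 :+ I :* d) :+ con 1)
             := (con 1 :+ I :* J :* d′) :* (con 1 :+ I :* d)) ≈-refl I J d d′ ⟩
      (1# + I * J * d′) * (1# + I * d) ∎)
    where
    E = nat (suc e)
    J = nat j + 1#
    I = nat (j +ℕ suc e) + 1#
    I≈ : I ≈ J + E
    I≈ = ≈-trans (+-congʳ (nat-+ j (suc e)))
      (solve 2 (λ x y → x :+ y :+ con 1 := x :+ con 1 :+ y) ≈-refl (nat j) E)

  -- Gödel's choice of `d`: the factor k! is divisible by all differences of indices, which makes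
  -- the moduli coprime, and the factor `S` exceeds every value to be coded, so that the values are
  -- remainders.
  β-code : ∀ (s : ℕ → D) k → C (∃ λ c → ∃ λ d → ∀ i → i ≤ℕ k → C (Entry c d (nat i) (s i)))
  β-code s k = do
    c , c≡s ← chinese-remainder (λ i → modulus d (nat i)) s (suc k) (λ _ → 1+-nonzero) coprime (suc k) ℕ.≤-refl
    return (c , d , λ i i≤k → do
      q , e ← c≡s i (s≤s i≤k)
      return (entry (≤-trans (≤-trans (≤-sum (ℕ.≤⇒≤′ (s≤s i≤k))) (≤-trans (x≤x*y S F≉0) (≤-reflexive (*-comm S F))))
        (≤-resp (*-identityˡ d) ≈-refl (*-mono-≤ (≤-intro (nat i) (+-comm 1# (nat i))) ≤-refl))) e))
    where
    S = sum s (suc k)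
    F = nat (k !)
    d = F * S
    F≉0 : F ≉ 0#
    F≉0 = nat≉0 (k !) {{k ℕ.!≢0}}
    coprime : ∀ {i j} → j <ℕ i → i <ℕ suc k → Invertible (modulus d (nat i)) (modulus d (nat j))
    coprime {i} {j} j<i (s≤s i≤k) with ℕ.m≤n⇒∃[o]m+o≡n j<i
    ... | e , refl = subst (λ i → Invertible (modulus d (nat i)) (modulus d (nat j))) (ℕ.+-suc j e)
      (modulus-invertible d j (begin
        nat (suc e) * (nat q * S)  ≈⟨ solve 3 (λ x y z → x :* (y :* z) := y :* x :* z) ≈-refl (nat (suc e)) (nat q) S ⟩
        nat q * nat (suc e) * S    ≈⟨ *-congʳ (≈-trans (≈-sym (nat-* q (suc e))) (≈-reflexive (cong nat (sym k!≡)))) ⟩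
        F * S                      ∎) (*-nonzero F≉0 (sum≉0 s (suc k))))
      where
      open ℕ._∣_ (∣! (ℕ.≤-trans (ℕ.m≤n+m (suc e) j) (ℕ.≤-trans (ℕ.≤-reflexive (ℕ.+-suc j e)) i≤k)))
        renaming (quotient to q; equality to k!≡)

  -- For standard `k` the whole sequence of powers is coded at once. An index below `y` in the
  -- recursion is standard by `<nat⇒`, so each step is an identity between external powers.
  ⟦Exp⟧-^ : ∀ {x y z} k → y ≈ nat k → z ≈ x ^ k → ⟦ Exp {L} v₂ v₁ v₀ ⟧ (z ∷ y ∷ x ∷ [])
  ⟦Exp⟧-^ {x} {y} {z} k y≈k z≈x^k ¬exp = β-code (x ^_) k λ (c , d , codes) →
    let at : ∀ {i v} j → j ≤ℕ k → i ≈ nat j → v ≈ x ^ j → ⟦β⟧ c d i v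
        at j j≤k i≈j v≈ = β⇐ c d do
          en ← codes j j≤k
          return (entry-respʳ c d (≈-sym v≈) (entry-respˡ c d (≈-sym i≈j) en))
        v≤c : ∀ {i v} → ⟦β⟧ c d i v → v ≤ c
        v≤c βv = ≤-stable do
          entry _ e ← β⇒ c d βv
          return (≤-intro _ (≈-trans (+-comm _ _) (≈-sym e)))
    in ¬exp c λ ¬d → ¬d d λ h → h (at 0 z≤n ≈-refl ≈-refl) λ h′ → h′
      (λ i _ i<y k′ → <nat⇒ k (<-≤-trans (⟦<⟧⇒ i<y) (≤-reflexive y≈k)) λ (j , j<k , i≈j) →
        let βj  = at j (ℕ.<⇒≤ j<k) i≈j ≈-refl
            βj′ = at (suc j) j<k (+-congʳ i≈j) ≈-refl
        in k′ (x ^ j) λ k₁ → k₁ (v≤c βj) λ k₂ → k₂ (x ^ suc j) λ k₃ → k₃ (v≤c βj′) λ k₄ →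
           k₄ βj λ k₅ → k₅ βj′ (*-comm x (x ^ j)))
      (at k ℕ.≤-refl y≈k z≈x^k)

  -- Standard powers and the abc inequality

  ⟦numeral⟧ : ∀ {l n} k (ρ : Vec D n) → ⟦ numeral {l} k ⟧ᵗ ρ ≈ nat k
  ⟦numeral⟧ zero    ρ = ≈-refl
  ⟦numeral⟧ {l} (suc k) ρ = +-congʳ (⟦numeral⟧ {l} k ρ)

  ⟦^̇⟧ : ∀ {l n} (t : Term l n) k (ρ : Vec D n) → ⟦ t ^̇ k ⟧ᵗ ρ ≈ ⟦ t ⟧ᵗ ρ ^ k
  ⟦^̇⟧ t zero    ρ = ≈-refl
  ⟦^̇⟧ t (suc k) ρ = ≈-trans (*-congʳ (⟦^̇⟧ t k ρ)) (*-comm _ _)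

  ^-nonzero : ∀ {x} n → x ≉ 0# → x ^ n ≉ 0#
  ^-nonzero zero    x≉0 = 1≉0
  ^-nonzero (suc n) x≉0 = *-nonzero x≉0 (^-nonzero n x≉0)

  ^-monoˡ-≤ : ∀ {x y} n → x ≤ y → x ^ n ≤ y ^ n
  ^-monoˡ-≤ zero    x≤y = ≤-refl
  ^-monoˡ-≤ (suc n) x≤y = *-mono-≤ x≤y (^-monoˡ-≤ n x≤y)

  ^-monoˡ-< : ∀ {x y} n .{{_ : NonZero n}} → x < y → x ^ n < y ^ n
  ^-monoˡ-< (suc n) x<y@(x≤y , _) = ≤-<-trans (*-mono-≤ ≤-refl (^-monoˡ-≤ n x≤y))
    (*-mono-<ʳ (^-nonzero n (1≤⇒nonzero (≤-trans (x≤x+z 1# _) (<⇒1+≤ x<y)))) x<y)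

  ^-monoʳ-≤ : ∀ {x j k} → x ≉ 0# → j ≤ℕ k → x ^ j ≤ x ^ k
  ^-monoʳ-≤ {k = k} x≉0 z≤n = nonzero⇒1≤ (^-nonzero k x≉0)
  ^-monoʳ-≤ x≉0 (s≤s j≤k)   = *-mono-≤ ≤-refl (^-monoʳ-≤ x≉0 j≤k)

  nat-mono-≤ : ∀ {j k} → j ≤ℕ k → nat j ≤ nat k
  nat-mono-≤ z≤n       = 0≤
  nat-mono-≤ (s≤s j≤k) = +-mono-≤ (nat-mono-≤ j≤k) ≤-refl

  nat≤2^ : ∀ k → nat k ≤ nat 2 ^ k
  nat≤2^ zero    = 0≤
  nat≤2^ (suc k) = ≤-resp ≈-refl
    (solve 1 (λ x → x :+ x := (con 0 :+ con 1 :+ con 1) :* x) ≈-refl (nat 2 ^ k))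
    (+-mono-≤ (nat≤2^ k) (nonzero⇒1≤ (^-nonzero k (nat≉0 2))))

  -- For h = 3 (q + p) + K ≥ K we have K² ≤ 2^(2h) ≤ c, hence
  -- (K^q w^(q+p))^(2h) ≤ K^(2qh) c^(3(q+p)) ≤ c^(qh) c^(qh) = (c^q)^(2h).
  abc-bound : ∀ K p q′ {c r w} (let q = suc q′) (let h = 3 *ℕ (q +ℕ p) +ℕ K) (let 2h = h +ℕ h) →
    r ≤ w → w ^ 2h ≤ c ^ 3 → nat 2 ^ 2h ≤ c → c ^ q < nat K ^ q * r ^ (q +ℕ p) → ⊥
  abc-bound K p q′ {c} {r} {w} r≤w w^m≤c³ 2^m≤c c^q< = <-irrefl
    (≤-<-trans (≤-reflexive (≈-sym (^-assocʳ c q 2h))) (^-monoˡ-< 2h c^q<))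
    (≤-trans (^-monoˡ-≤ 2h (*-mono-≤ ≤-refl (^-monoˡ-≤ (q +ℕ p) r≤w)))
    (≤-trans (≤-reflexive expand)
    (≤-trans (*-mono-≤ κ-bound w-bound)
    (≤-reflexive (≈-sym (≈-trans (^-congʳ c (ℕ.*-distribˡ-+ q h h)) (^-homo-* c (q *ℕ h) (q *ℕ h))))))))
    where
    q = suc q′
    h = 3 *ℕ (q +ℕ p) +ℕ K
    2h = h +ℕ h
    κ = nat K
    c≉0 : c ≉ 0#
    c≉0 = 1≤⇒nonzero (≤-trans (nonzero⇒1≤ (^-nonzero 2h (nat≉0 2))) 2^m≤c)
    expand : (κ ^ q * w ^ (q +ℕ p)) ^ 2h ≈ (κ ^ q) ^ 2h * (w ^ 2h) ^ (q +ℕ p)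
    expand = begin
      (κ ^ q * w ^ (q +ℕ p)) ^ 2h        ≈⟨ ^-distrib-* (κ ^ q) (w ^ (q +ℕ p)) 2h ⟩
      (κ ^ q) ^ 2h * (w ^ (q +ℕ p)) ^ 2h  ≈⟨ *-congˡ (begin
        (w ^ (q +ℕ p)) ^ 2h              ≈⟨ ^-assocʳ w (q +ℕ p) 2h ⟩
        w ^ ((q +ℕ p) *ℕ 2h)             ≡⟨ cong (w ^_) (ℕ.*-comm (q +ℕ p) 2h) ⟩
        w ^ (2h *ℕ (q +ℕ p))             ≈⟨ ≈-sym (^-assocʳ w 2h (q +ℕ p)) ⟩
        (w ^ 2h) ^ (q +ℕ p)              ∎) ⟩
      (κ ^ q) ^ 2h * (w ^ 2h) ^ (q +ℕ p)  ∎
    κ-bound : (κ ^ q) ^ 2h ≤ c ^ (q *ℕ h)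
    κ-bound = ≤-trans (≤-reflexive (begin
        (κ ^ q) ^ 2h                    ≈⟨ ^-assocʳ κ q 2h ⟩
        κ ^ (q *ℕ 2h)                   ≡⟨ cong (κ ^_) (ℕ.*-distribˡ-+ q h h) ⟩
        κ ^ (q *ℕ h +ℕ q *ℕ h)         ≈⟨ ^-homo-* κ (q *ℕ h) (q *ℕ h) ⟩
        κ ^ (q *ℕ h) * κ ^ (q *ℕ h)    ≈⟨ ≈-sym (^-distrib-* κ κ (q *ℕ h)) ⟩
        (κ * κ) ^ (q *ℕ h)             ∎))
      (^-monoˡ-≤ (q *ℕ h) (≤-trans (*-mono-≤ κ≤2^h κ≤2^h)
        (≤-trans (≤-reflexive (≈-sym (^-homo-* (nat 2) h h))) 2^m≤c)))
      where
      κ≤2^h = ≤-trans (nat-mono-≤ (ℕ.m≤n+m K (3 *ℕ (q +ℕ p)))) (nat≤2^ h)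
    w-bound : (w ^ 2h) ^ (q +ℕ p) ≤ c ^ (q *ℕ h)
    w-bound = ≤-trans (^-monoˡ-≤ (q +ℕ p) w^m≤c³) (≤-trans (≤-reflexive (^-assocʳ c 3 (q +ℕ p)))
      (^-monoʳ-≤ c≉0 (ℕ.≤-trans (ℕ.m≤m+n _ K) (ℕ.m≤n*m h q))))

-- Exponentiation in models of Exp′

module FermatForExp {ℓ} (T : Theory L ℓ) (T⊇IΣ₁ : Extends T IΣ₁) (K : ℕ) (ε : ℚ)
  (T⊢ABC : T ⊢ ABC K ε) (T⊢FLT : T ⊢ FLT) (M : Structure ℓ)
  (models : Semantics.Models M (((⌜ T ⌝ ∪ Exp′) ∪ ｛ e5′ ｝) ∪ ｛ e8 ｝)) where

  open Structure M
  open Semantics M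

  ⊨T : Models T
  ⊨T {ψ} Tψ = ⟦embed⟧⇒ ψ (models (inj₁ (inj₁ (inj₁ (ψ , Tψ , refl)))))

  ⊢⇒⟦⟧ : ∀ {φ} → T ⊢ φ → ⟦ φ ⟧ []
  ⊢⇒⟦⟧ d = soundness ⊨T d []

  ⊨IΣ₁ : ∀ {φ} → IΣ₁ φ → ⟦ φ ⟧ []
  ⊨IΣ₁ {φ} p = ⊢⇒⟦⟧ (T⊇IΣ₁ φ p)

  open Arithmetic M ⊨IΣ₁
  open import Relation.Binary.Reasoning.Setoid setoid

  ⊨Exp′ : ∀ {φ} → Exp′ φ → ⟦ φ ⟧ []
  ⊨Exp′ p = models (inj₁ (inj₁ (inj₂ p)))

  nat∈A : ∀ k → A (nat k)
  nat∈A zero    = ⊨Exp′ e0-0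
  nat∈A (suc k) = ⊨Exp′ e0-+ _ _ (nat∈A k) (⊨Exp′ e0-1)

  -- The difference supplied by PA⁻ might lie outside A, where (e4) does not apply; hence the appeal
  -- to `≤-def` relativised to A.
  ≤-diff-A : ∀ {x y} → A x → A y → x ≤ y → C (∃ λ z → A z × x + z ≈ y)
  ≤-diff-A Ax Ay x≤y = do
    diff , _ ← some (⊨Exp′ (e0-Pr ≤-def) _ Ax _ Ay)
    λ k → diff x≤y λ z Az e → k (z , Az , e)

  exp-0 : ∀ x → exp x 0# ≈ 1#
  exp-0 x = ≈-stable do
    to , _ ← some (⊨Exp′ e1 x 0# (nat∈A 0))
    return (to λ x≉1 → ≈-refl)

  exp-1ˡ : ∀ {n} → A n → exp 1# n ≈ 1#
  exp-1ˡ An = ≈-stable do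
    to , _ ← some (⊨Exp′ e1 1# _ An)
    return (to λ 1≉1 → ≈⊥ (1≉1 ≈-refl))

  exp-nonzero : ∀ {x n} → A n → x ≉ 0# → exp x n ≉ 0#
  exp-nonzero An x≉0 = ⊨Exp′ e2 _ _ An x≉0

  exp-1ʳ : ∀ x → exp x 1# ≈ x
  exp-1ʳ = ⊨Exp′ e3

  exp-+ : ∀ x {y z} → A y → A z → exp x (y + z) ≈ exp x y * exp x z
  exp-+ x = ⊨Exp′ e4 x _ _

  exp-* : ∀ x y {n} → A n → exp (x * y) n ≈ exp x n * exp y n
  exp-* x y = models (inj₁ (inj₂ refl)) x y _

  exp-coprime : ∀ {x y a b} → A a → A b → Coprimeᴹ x y → Coprimeᴹ (exp x a) (exp y b)
  exp-coprime = models (inj₂ refl) _ _ _ _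

  exp-nat : ∀ x k → exp x (nat k) ≈ x ^ k
  exp-nat x zero    = exp-0 x
  exp-nat x (suc k) = begin
    exp x (nat k + 1#)        ≈⟨ exp-+ x (nat∈A k) (⊨Exp′ e0-1) ⟩
    exp x (nat k) * exp x 1#  ≈⟨ *-cong (exp-nat x k) (exp-1ʳ x) ⟩
    x ^ k * x                 ≈⟨ *-comm _ x ⟩
    x * x ^ k                 ∎

  -- By (e4) the standard power splits off, and the cofactor, an exponential with exponent n - k in
  -- A, is nonzero by (e2).
  ^≤exp : ∀ {x n} k → A n → x ≉ 0# → nat k ≤ n → x ^ k ≤ exp x n
  ^≤exp {x} {n} k An x≉0 k≤n = ≤-stable do
    z , Az , k+z≈n ← ≤-diff-A (nat∈A k) An k≤n
    return (≤-trans (x≤x*y (x ^ k) (exp-nonzero Az x≉0)) (≤-reflexive (begin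
      x ^ k * exp x z          ≈⟨ *-congʳ (≈-sym (exp-nat x k)) ⟩
      exp x (nat k) * exp x z  ≈⟨ ≈-sym (exp-+ x (nat∈A k) Az) ⟩
      exp x (nat k + z)        ≈⟨ exp-cong ≈-refl k+z≈n ⟩
      exp x n                  ∎)))

  -- Otherwise `p` and `x` are coprime, and (e8) with exponents 1 and `n` makes p = e(p,1) coprime
  -- to e(x,n), which it divides.
  prime-∣-exp : ∀ {p x n} → A n → Primeᴹ p → p ∣ exp x n → p ∣ x
  prime-∣-exp {p} An pr p∣ = ∣-C do
    inj₂ p∤x ← excluded-middle
      where inj₁ p∣x → return p∣x
    λ _ → proj₂ (proj₁ pr) (≈-sym (exp-coprime (⊨Exp′ e0-1) An (prime∤⇒coprime pr p∤x) p
      (∣-respʳ (≈-sym (exp-1ʳ p)) ∣-refl) p∣))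

  Solution : (n x y z : D) → Set ℓ
  Solution n x y z = x ≉ 0# × y ≉ 0# × z ≉ 0# × exp x n + exp y n ≈ exp z n

  -- Let x = g x′, y = g y′ and g = h g′, z = h z′, with x′, y′ and g′, z′ coprime pairs. Cancelling
  -- e(h,n) leaves e(g′,n) (e(x′,n) + e(y′,n)) = e(z′,n). So e(g′,n) divides e(z′,n), to which it is
  -- coprime by (e8), and hence equals 1.
  coprime-solution : ∀ {n x y z} → A n → Solution n x y z →
    C (∃ λ x′ → ∃ λ y′ → ∃ λ z′ → Coprimeᴹ x′ y′ × Solution n x′ y′ z′)
  coprime-solution {n} {x} {y} {z} An (x≉0 , y≉0 , z≉0 , e) = do
    g , x′ , y′ , x≈ , y≈ , x′y′-coprime ← coprime-reduction x y x≉0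
    let g≉0 = *-nonzeroˡ (≉-resp x≈ x≉0)
    h , g′ , z′ , g≈ , z≈ , g′z′-coprime ← coprime-reduction g z g≉0
    let a = exp x′ n + exp y′ n
        h^n≉0 = exp-nonzero An (*-nonzeroˡ (≉-resp g≈ g≉0))
        g′^n*a≈ = *-cancelˡ h^n≉0 (begin
          exp h n * (exp g′ n * a)               ≈⟨ ≈-sym (*-assoc (exp h n) (exp g′ n) a) ⟩
          exp h n * exp g′ n * a                 ≈⟨ *-congʳ (≈-sym (≈-trans (exp-cong g≈ ≈-refl) (exp-* h g′ An))) ⟩
          exp g n * a                            ≈⟨ solve 3 (λ g x y → g :* (x :+ y) := g :* x :+ g :* y) ≈-refl (exp g n) (exp x′ n) (exp y′ n) ⟩
          exp g n * exp x′ n + exp g n * exp y′ n ≈⟨ +-cong (factor x≈) (factor y≈) ⟩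
          exp x n + exp y n                      ≈⟨ e ⟩
          exp z n                                ≈⟨ ≈-sym (factor z≈) ⟩
          exp h n * exp z′ n                     ∎)
        g′^n≈1 = exp-coprime An An g′z′-coprime (exp g′ n) ∣-refl (∣-intro a g′^n*a≈)
    return (x′ , y′ , z′ , x′y′-coprime , *-nonzeroʳ (≉-resp x≈ x≉0) , *-nonzeroʳ (≉-resp y≈ y≉0) ,
      *-nonzeroʳ (≉-resp z≈ z≉0) , ≈-trans (≈-sym (*-identityˡ a)) (≈-trans (*-congʳ (≈-sym g′^n≈1)) g′^n*a≈))
    where
    factor : ∀ {u v w} → w ≈ u * v → exp u n * exp v n ≈ exp w n
    factor {u} {v} w≈uv = ≈-sym (≈-trans (exp-cong w≈uv ≈-refl) (exp-* u v An))

  no-standard-solution : ∀ {n x y z} k → nat 2 < n → n ≈ nat k → Solution n x y z → ⊥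
  no-standard-solution {n} {x} {y} {z} k 2<n n≈k (x≉0 , y≉0 , z≉0 , e) =
    ⊢⇒⟦⟧ T⊢FLT x y z n x≉0 y≉0 z≉0 (⟦<⟧⇐ 2<n) λ k₁ → k₁ (x ^ k) λ k₂ → k₂ (y ^ k) λ k₃ → k₃ (z ^ k)
      λ k₄ → k₄ (⟦Exp⟧-^ k n≈k ≈-refl) λ k₅ → k₅ (⟦Exp⟧-^ k n≈k ≈-refl) λ k₆ → k₆ (⟦Exp⟧-^ k n≈k ≈-refl)
      (≈-trans (+-cong (≈-sym (pow x)) (≈-sym (pow y))) (≈-trans e (pow z)))
    where
    pow : ∀ x → exp x n ≈ x ^ k
    pow x = ≈-trans (exp-cong ≈-refl n≈k) (exp-nat x k)

  p q : ℕ
  p = ℤ.∣ ↥ ε ∣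
  q = ↧ₙ ε

  threshold : ℕ
  threshold = (3 *ℕ (q +ℕ p) +ℕ K) +ℕ (3 *ℕ (q +ℕ p) +ℕ K)

  no-large-coprime-solution : ∀ {n x y z} → A n → nat threshold ≤ n → Coprimeᴹ x y → Solution n x y z → ⊥
  no-large-coprime-solution {n} {x} {y} {z} An m≤n xy-coprime (x≉0 , y≉0 , z≉0 , e) =
    some (⊢⇒⟦⟧ T⊢ABC a b c (exp-nonzero An x≉0) (exp-nonzero An y≉0) ab-coprime
      (λ d d∣a d∣c → ab-coprime d d∣a (∣-+-cancelˡ d∣a (∣-respʳ (≈-sym e) d∣c)))
      (λ d d∣b d∣c → ab-coprime d (∣-+-cancelʳ d∣b (∣-respʳ (≈-sym e) d∣c)) d∣b) e) λ (r , h) →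
    some h λ (rad , c^q<) → abc-bound K p (ℚ.denominator-1 ε)
      (rad≤ (*-nonzero (*-nonzero x≉0 y≉0) z≉0) prime-divisors rad)
      (≤-resp (≈-sym (≈-trans (^-distrib-* (x * y) z threshold) (*-congʳ (^-distrib-* x y threshold))))
        (solve 1 (λ c → c :* c :* c := c :* (c :* (c :* con 1))) ≈-refl c)
        (*-mono-≤ (*-mono-≤ x^m≤c y^m≤c) z^m≤c))
      (≤-trans (^-monoˡ-≤ threshold (≤-resp (solve 0 (con 1 :+ con 1 := con 0 :+ con 1 :+ con 1) ≈-refl) ≈-refl 2≤z)) z^m≤c)
      (<-resp (⟦^̇⟧ {L} v₁ q (r ∷ c ∷ b ∷ a ∷ []))
        (*-cong (≈-trans (⟦^̇⟧ {L} (numeral K) q (r ∷ c ∷ b ∷ a ∷ [])) (^-congˡ q (⟦numeral⟧ {L} K _)))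
                (⟦^̇⟧ {L} v₀ (q +ℕ p) (r ∷ c ∷ b ∷ a ∷ [])))
        (⟦<⟧⇒ c^q<))
    where
    a = exp x n
    b = exp y n
    c = exp z n
    <-resp : ∀ {x x′ y y′} → x ≈ x′ → y ≈ y′ → x < y → x′ < y′
    <-resp x≈x′ y≈y′ x<y = <-≤-trans (≤-<-trans (≤-reflexive (≈-sym x≈x′)) x<y) (≤-reflexive y≈y′)
    ab-coprime : Coprimeᴹ a b
    ab-coprime = exp-coprime An An xy-coprime
    x^m≤c = ≤-trans (^≤exp threshold An x≉0 m≤n) (≤-intro b e)
    y^m≤c = ≤-trans (^≤exp threshold An y≉0 m≤n) (≤-intro a (≈-trans (+-comm b a) e))
    z^m≤c = ^≤exp threshold An z≉0 m≤n
    -- If z = 1, then e(z,n) = 1, although it is a sum of two nonzero terms. With `z^m≤c` this gives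
    -- the bound 2^m ≤ c that absorbs K.
    2≤z : 1# + 1# ≤ z
    2≤z = <⇒1+≤ (nonzero⇒1≤ z≉0 , λ 1≈z → <-irrefl (1+≤⇒< (≤-resp ≈-refl
      (≈-trans e (≈-trans (exp-cong (≈-sym 1≈z) ≈-refl) (exp-1ˡ An)))
      (+-mono-≤ (nonzero⇒1≤ (exp-nonzero An x≉0)) (nonzero⇒1≤ (exp-nonzero An y≉0))))) ≤-refl)
    prime-divisors : ∀ p → Primeᴹ p → p ∣ a * b * c → p ∣ x * y * z
    prime-divisors p pr p∣abc = ∣-C do
      inj₁ p∣ab ← prime-∣-* pr p∣abc
        where inj₂ p∣c → return (∣-*ˡ (x * y) (prime-∣-exp An pr p∣c))
      inj₁ p∣a ← prime-∣-* pr p∣ab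
        where inj₂ p∣b → return (∣-*ʳ z (∣-*ˡ x (prime-∣-exp An pr p∣b)))
      return (∣-*ʳ z (∣-*ʳ y (prime-∣-exp An pr p∣a)))

  no-solution : ∀ {n x y z} → A n → nat 2 < n → Solution n x y z → ⊥
  no-solution {n} An 2<n s = ≤-or-> (nat threshold) n λ where
    (inj₁ m≤n) → coprime-solution An s
      λ (_ , _ , _ , coprime , s′) → no-large-coprime-solution An m≤n coprime s′
    (inj₂ n<m) → <nat⇒ threshold n<m λ (k , _ , n≈k) → no-standard-solution k 2<n n≈k s

  ⊨FLTᵉ : ⟦ FLTᵉ ⟧ []
  ⊨FLTᵉ h =
    some h  λ (x , h) → some h λ (y , h) → some h λ (z , h) → some h λ (n , h) →
    some h  λ (x≉0 , h) → some h λ (y≉0 , h) → some h λ (z≉0 , h) → some h λ (An , h) → some h λ (2<n , e) →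
    no-solution An (⟦<⟧⇒ 2<n) (x≉0 , y≉0 , z≉0 , e)

theorem6p1 : ∀ {ℓ : Level} (T : Theory L ℓ) →
    Extends T IΣ₁ →
    (∃[ K ] ∃[ ε ] (0ℚ <ℚ ε × (T ⊢ ABC K ε))) →
    (T ⊢ FLT) →
    (((⌜ T ⌝ ∪ Exp′) ∪ ｛ e5′ ｝) ∪ ｛ e8 ｝) ⊢ FLTᵉ
theorem6p1 T T⊇IΣ₁ (K , ε , _ , T⊢ABC) T⊢FLT = completeness _ FLTᵉ
  λ M models → FermatForExp.⊨FLTᵉ T T⊇IΣ₁ K ε T⊢ABC T⊢FLT M models
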